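{- Let $N$ be a normalizing function. Then computing $N(A)$ for an arbitrary sequence of formulas $A$ is as hard as solving graph isomorphism; that is, the problem of deciding whether two given finite undirected graphs are isomorphic is polynomial-time (Turing) reducible to the problem of computing $N(A)$ for a given sequence of formulas $A$.
   Context: **Formulas.** We work in many-sorted logic with a signature of sorted function symbols, including a Boolean sort $\mathtt{Bool}$ (relation symbols are function symbols with return sort $\mathtt{Bool}$) and equality. Symbols are partitioned into theory symbols (e.g. $=,\land,\lor,+,-,0,1$) and user-defined symbols (e.g. $f,g,x,y$; these include predicate and function symbols), with an infinite supply of variables of each sort. A formula is represented as a finite sequence of symbols in prefix notation; each symbol has a fixed arity, so this is unambiguous. For a sequence $S$, $|S|$ is its length, $S_i$ is its $i$-th element, $\circ$ is concatenation, and $[n]=\{1,\dots,n\}$. Some binary theory symbols (e.g. $=,+,*$, in particular equality) are designated commutative operators. **Shuffle set.** For a sequence $A$ of formulas, $S(A)=\{A' \mid A' \text{ is a permutation of } A\}$. **Commutative reordering set.** For a formula $\alpha$, $C(\alpha)$ is the set of formulas obtained from $\alpha$ by swapping the operands of zero or more occurrences of (binary) commutative operators in $\alpha$. For a sequence $A=\langle\alpha_1,\dots,\alpha_n\rangle$ of formulas, $C(A)$ is the set of all sequences $\langle\alpha_1',\dots,\alpha_n'\rangle$ with $\alpha_i'\in C(\alpha_i)$ for each $i\in[n]$. For a set $X$ (of formulas or of sequences of formulas), $C(X)=\{x' \mid x'\in C(x)\text{ for some }x\in X\}$. **Pattern.** For a formula $\alpha$, its pattern $P(\alpha)$ is the sequence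 of length $|\alpha|$ with, for $i\in[|\alpha|]$: $P(\alpha)_i=\alpha_i$ if $\alpha_i$ is a theory symbol; $P(\alpha)_i=@1$ if $\alpha_i$ is the first user-defined symbol appearing in $\alpha$; $P(\alpha)_i=P(\alpha)_j$ if $\alpha_i$ is a user-defined symbol and there is $j\in[i-1]$ with $\alpha_j=\alpha_i$; and otherwise $P(\alpha)_i=@k$ with $k=1+|\{\alpha_j\mid j\in[i-1],\ \alpha_j\text{ user-defined}\}|$. (So user-defined symbols are replaced by $@1,@2,\dots$ in order of first occurrence.) Each $@k$ is a fresh symbol of the same sort (and arity) as the symbol it replaces, so that patterns are well-sorted formulas. The symbols $@k$ are called pattern symbols; they are not theory symbols, and are treated as user-defined symbols when $P$ is applied to a pattern. **Lifting to sequences and sets.** For $A=\langle\alpha_1,\dots,\alpha_n\rangle$, $\mathit{Conj}(A)=\langle\wedge\rangle\circ\alpha_1\circ\cdots\circ\alpha_n$, and $\mathit{Unconj}$ maps $\langle\wedge\rangle\circ\alpha_1\circ\cdots\circ\alpha_n$ back to $\langle\alpha_1,\dots,\alpha_n\rangle$. Set $P(A)=\mathit{Unconj}(P(\mathit{Conj}(A)))$ (so numbering of pattern symbols runs through the whole sequence). For a set $X$ (of formulas or sequences of formulas), $P(X)=\{P(x)\mid x\in X\}$. **Renaming.** Let $V$ be a set of variables. A renaming $R$ is an injective function from pattern symbols to $V$, preserving sort and arity; $V$ may be the set of pattern symbols itself, so that the identity is a renaming. For a formula $\alpha$ built from theory symbols and pattern symbols, $R(\alpha)$ is the sequence of the same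 length with $R(\alpha)_i=\alpha_i$ if $\alpha_i$ is a theory symbol and $R(\alpha)_i=R(\alpha_i)$ if $\alpha_i$ is a pattern symbol. For a sequence, $R(\langle\alpha_1,\dots,\alpha_n\rangle)=\langle R(\alpha_1),\dots,R(\alpha_n)\rangle$. **Normalizing function.** A function $N$ from sequences of formulas to sequences of formulas is normalizing if for every sequence $A$ of formulas: (1) $N(A)=R(A')$ for some $A'\in P(C(S(A)))$ and some renaming $R$; and (2) if $M_1=R_1(M_1')$ and $M_2=R_2(M_2')$ with $R_1,R_2$ renamings and $M_1',M_2'\in P(C(S(A)))$, then $N(M_1)=N(M_2)$. -}

module Defs where

open import Data.Bool.Base using (Bool; true; false)
open import Data.Bool.Properties using () renaming (_≟_ to _≟ᵇ_)
open import Data.Fin.Base using (Fin; zero)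
open import Data.List.Base
  using (List; []; _∷_; [_]; _++_; map; concatMap; mapMaybe; length;
         tabulate; takeWhile; deduplicate)
open import Data.List.Properties using (≡-dec)
open import Data.List.Relation.Binary.Permutation.Propositional using (_↭_)
open import Data.List.Relation.Binary.Pointwise using (Pointwise)
open import Data.List.Relation.Unary.All using (All; []; _∷_)
open import Data.Maybe.Base using (Maybe; just; nothing)
open import Data.Nat.Base as ℕ using (ℕ; suc; _≤_)
open import Data.Nat.Binary.Base using (ℕᵇ; zero; 2[1+_]; 1+[2_]; fromℕ)
open import Data.Nat.Properties using () renaming (_≟_ to _≟ⁿ_)
open import Data.Product.Base using (Σ; ∃; ∃-syntax; _×_; _,_)
open import Data.Product.Properties using () renaming (≡-dec to ×-≡-dec)
open import Data.Vec.Base using (Vec; lookup; replicate; _[_]≔_; _∷_)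
open import Function.Bundles using (_↔_; _↣_; Inverse; Injection)
open import Level using (0ℓ)
open import Relation.Binary.Definitions using (DecidableEquality)
open import Relation.Binary.PropositionalEquality using (_≡_; _≢_; refl; cong)
open import Relation.Nullary.Decidable using (no; ¬?; map′; via-injection)
open import Relation.Nullary.Reflects using (Reflects)
open import Relation.Unary using (Pred; _∈_)

------------------------------------------------------------------------
-- Words

data Letter : Set where
  bit                         : Bool → Letter
  comma semi                  : Letter
  tagTheory tagUser tagPat    : Letter

Word : Set
Word = List Letter

Bits : Set
Bits = List Bool

bits : Bits → Word
bits = map bit

-- Bijective binary numeration, least significant digit first.
binary : ℕ → Bits
binary n = digits (fromℕ n)
  where
  digits : ℕᵇ → Bits
  digits zero     = []
  digits 2[1+ m ] = true  ∷ digits m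
  digits 1+[2 m ] = false ∷ digits m

------------------------------------------------------------------------
-- Formulas

-- The theory part of a many-sorted signature.  The codes name sorts and
-- theory symbols when formulas are written on a tape; a theory symbol only
-- has to be identified by its code among the symbols of the same rank.
record Signature : Set₁ where
  field
    Sort          : Set
    bool          : Sort
    Theory        : List Sort → Sort → Set
    equality      : ∀ s → Theory (s ∷ s ∷ []) bool
    Commutative   : ∀ {s t} → Theory (s ∷ s ∷ []) t → Set
    equality-comm : ∀ s → Commutative (equality s)
    sortCode      : Sort ↣ Bits
    theoryCode    : ∀ {as s} → Theory as s ↣ Bits

-- The non-theory symbols: every rank has infinitely many user-defined
-- symbols, named by bit strings, and the pattern symbols @1, @2, @3, …
-- `pat n` is @(n+1), so that there is no spurious pattern symbol @0.
data Name : Set where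
  user : Bits → Name
  pat  : ℕ → Name

_≟ᴺ_ : DecidableEquality Name
user x ≟ᴺ user y = map′ (cong user) (λ { refl → refl }) (≡-dec _≟ᵇ_ x y)
user x ≟ᴺ pat n  = no λ ()
pat m  ≟ᴺ user y = no λ ()
pat m  ≟ᴺ pat n  = map′ (cong pat) (λ { refl → refl }) (m ≟ⁿ n)

module Logic (𝒮 : Signature) where
  open Signature 𝒮

  Rank : Set
  Rank = List Sort × Sort

  FreeSymbol : Set
  FreeSymbol = Rank × Name

  data Symbol : Rank → Set where
    theory : ∀ {as s} → Theory as s → Symbol (as , s)
    free   : ∀ {r} → Name → Symbol r

  data Term : Sort → Set where
    app : ∀ {as s} → Symbol (as , s) → All Term as → Term s

  Formula : Set
  Formula = Term bool

  -- The sequence of symbols of a term in prefix notation.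
  mutual
    prefix : ∀ {s} → Term s → List (Σ Rank Symbol)
    prefix (app {as} {s} σ ts) = ((as , s) , σ) ∷ prefixes ts

    prefixes : ∀ {as} → All Term as → List (Σ Rank Symbol)
    prefixes []       = []
    prefixes (t ∷ ts) = prefix t ++ prefixes ts

  ----------------------------------------------------------------------
  -- Shuffling and commutative reordering

  S : List Formula → Pred (List Formula) 0ℓ
  S A A′ = A′ ↭ A

  -- t′ ∈ᶜ t : t′ results from t by swapping the operands of zero or more
  -- occurrences of commutative operators.
  infix 4 _∈ᶜ_ _∈ᶜ*_
  mutual
    data _∈ᶜ_ : ∀ {s} → Term s → Term s → Set where
      keep : ∀ {as s} {σ : Symbol (as , s)} {ts′ ts} →
             ts′ ∈ᶜ* ts → app σ ts′ ∈ᶜ app σ ts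
      swap : ∀ {s r} {f : Theory (s ∷ s ∷ []) r} {t′ t u′ u} →
             Commutative f → t′ ∈ᶜ t → u′ ∈ᶜ u →
             app (theory f) (u′ ∷ t′ ∷ []) ∈ᶜ app (theory f) (t ∷ u ∷ [])

    data _∈ᶜ*_ : ∀ {as} → All Term as → All Term as → Set where
      []  : [] ∈ᶜ* []
      _∷_ : ∀ {s as} {t′ t : Term s} {ts′ ts : All Term as} →
            t′ ∈ᶜ t → ts′ ∈ᶜ* ts → (t′ ∷ ts′) ∈ᶜ* (t ∷ ts)

  C : Pred (List Formula) 0ℓ → Pred (List Formula) 0ℓ
  C X A′ = ∃[ A ] A ∈ X × Pointwise _∈ᶜ_ A′ A

  ----------------------------------------------------------------------
  -- Patterns

  mutual
    rename : (FreeSymbol → Name) → ∀ {s} → Term s → Term s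
    rename ρ (app (theory f) ts)         = app (theory f) (renames ρ ts)
    rename ρ (app {as} {s} (free x) ts)  = app (free (ρ ((as , s) , x))) (renames ρ ts)

    renames : (FreeSymbol → Name) → ∀ {as} → All Term as → All Term as
    renames ρ []       = []
    renames ρ (t ∷ ts) = rename ρ t ∷ renames ρ ts

  _≟ᶠ_ : DecidableEquality FreeSymbol
  _≟ᶠ_ = ×-≡-dec (×-≡-dec (≡-dec _≟ˢ_) _≟ˢ_) _≟ᴺ_
    where
    _≟ˢ_ : DecidableEquality Sort
    _≟ˢ_ = via-injection sortCode (≡-dec _≟ᵇ_)

  freeSymbol : Σ Rank Symbol → Maybe FreeSymbol
  freeSymbol (r , theory f) = nothing
  freeSymbol (r , free x)   = just (r , x)

  -- The occurrences of non-theory symbols in Conj(A), from left to right;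
  -- the leading ∧ of Conj(A) is a theory symbol and contributes nothing.
  occurrences : List Formula → List FreeSymbol
  occurrences A = mapMaybe freeSymbol (concatMap prefix A)

  -- The n such that f becomes @(n+1): the number of distinct symbols
  -- occurring before the first occurrence of f.
  number : List FreeSymbol → FreeSymbol → ℕ
  number fs f = length (deduplicate _≟ᶠ_ (takeWhile (λ g → ¬? (g ≟ᶠ f)) fs))

  -- Unconj(P(Conj(A))).
  P : List Formula → List Formula
  P A = map (rename (λ f → pat (number (occurrences A) f))) A

  P[_] : Pred (List Formula) 0ℓ → Pred (List Formula) 0ℓ
  P[ X ] A′ = ∃[ A ] A ∈ X × A′ ≡ P A

  ----------------------------------------------------------------------
  -- Normalizing functions

  -- V may contain user-defined symbols and pattern symbols of any rank.  A
  -- pattern symbol is a rank together with a number; its image has the same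
  -- rank by construction, so injectivity is only needed rank by rank.
  record Renaming (V : Pred FreeSymbol 0ℓ) : Set where
    field
      image     : Rank → ℕ → Name
      image∈V   : ∀ r k → (r , image r k) ∈ V
      injective : ∀ r {k l} → image r k ≡ image r l → k ≡ l

    -- Only ever applied to patterns, in which no user-defined symbol occurs.
    onSymbol : FreeSymbol → Name
    onSymbol (r , user x) = user x
    onSymbol (r , pat k)  = image r k

  infixr 5 _·_
  _·_ : ∀ {V} → Renaming V → List Formula → List Formula
  R · A = map (rename (Renaming.onSymbol R)) A

  record Normalizing (V : Pred FreeSymbol 0ℓ)
                     (N : List Formula → List Formula) : Set where
    field
      renamed : ∀ A → ∃[ A′ ] A′ ∈ P[ C (S A) ] × ∃[ R ] N A ≡ _·_ {V} R A′
      unique  : ∀ A (R₁ R₂ : Renaming V) {M₁ M₂} →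
                M₁ ∈ P[ C (S A) ] → M₂ ∈ P[ C (S A) ] →
                N (R₁ · M₁) ≡ N (R₂ · M₂)

  ----------------------------------------------------------------------
  -- Formulas as words

  encodeRank : Rank → Word
  encodeRank (as , s) = concatMap (λ a → code a ++ [ comma ]) as ++ code s
    where
    code : Sort → Word
    code a = bits (Injection.to sortCode a)

  encodeSymbol : Σ Rank Symbol → Word
  encodeSymbol (r , σ) = encodeRank r ++ body σ ++ [ semi ]
    where
    body : ∀ {r} → Symbol r → Word
    body (theory f)      = tagTheory ∷ bits (Injection.to theoryCode f)
    body (free (user x)) = tagUser ∷ bits x
    body (free (pat k))  = tagPat ∷ bits (binary k)

  encodeFormulas : List Formula → Word
  encodeFormulas = concatMap (λ α → concatMap encodeSymbol (prefix α) ++ [ semi ])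

------------------------------------------------------------------------
-- Finite simple undirected graphs

record Graph : Set where
  field
    order     : ℕ
    adjacent  : Fin order → Fin order → Bool
    symmetric : ∀ u v → adjacent u v ≡ adjacent v u
    loopless  : ∀ v → adjacent v v ≡ false

open Graph

infix 4 _≅_
_≅_ : Graph → Graph → Set
G ≅ H = ∃ λ (π : Fin (order G) ↔ Fin (order H)) →
  ∀ u v → adjacent G u v ≡ adjacent H (Inverse.to π u) (Inverse.to π v)

-- The adjacency matrix, row by row.
encodeGraph : Graph → Word
encodeGraph G = concatMap (λ row → bits row ++ [ semi ])
                          (tabulate λ u → tabulate λ v → adjacent G u v)

------------------------------------------------------------------------
-- Polynomial-time oracle computation

-- Programs over k stacks of letters (two stacks amount to one tape of a
-- multitape Turing machine).  A branch is a finite table, indexed by the top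
-- letter of a stack or `nothing` if it is empty; a loop runs as long as a
-- stack is nonempty; a query replaces the word on a stack by the oracle's
-- answer to it.
infixr 5 _⨟_
data Program (k : ℕ) : Set where
  skip   : Program k
  push   : Letter → Fin k → Program k
  pop    : Fin k → Program k
  query  : Fin k → Program k
  _⨟_    : Program k → Program k → Program k
  branch : Fin k → (Maybe Letter → Program k) → Program k
  while  : Fin k → Program k → Program k

Store : ℕ → Set
Store k = Vec Word k

top : Word → Maybe Letter
top []      = nothing
top (a ∷ _) = just a

rest : Word → Word
rest []      = []
rest (_ ∷ w) = w

-- O ⊢ c , σ ⇓ τ ⟨ t ⟩ : with oracle O, program c started in σ halts in τ
-- after t steps.  A query is charged the length of the answer.
infix 3 _⊢_,_⇓_⟨_⟩
data _⊢_,_⇓_⟨_⟩ {k} (O : Word → Word) : Program k → Store k → Store k → ℕ → Set where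
  skip      : ∀ {σ} → O ⊢ skip , σ ⇓ σ ⟨ 1 ⟩
  push      : ∀ {σ a i} → O ⊢ push a i , σ ⇓ σ [ i ]≔ (a ∷ lookup σ i) ⟨ 1 ⟩
  pop       : ∀ {σ i} → O ⊢ pop i , σ ⇓ σ [ i ]≔ rest (lookup σ i) ⟨ 1 ⟩
  query     : ∀ {σ i} →
              O ⊢ query i , σ ⇓ σ [ i ]≔ O (lookup σ i) ⟨ suc (length (O (lookup σ i))) ⟩
  _⨟_       : ∀ {c d σ τ υ s t} →
              O ⊢ c , σ ⇓ τ ⟨ s ⟩ → O ⊢ d , τ ⇓ υ ⟨ t ⟩ →
              O ⊢ (c ⨟ d) , σ ⇓ υ ⟨ s ℕ.+ t ⟩
  branch    : ∀ {i f σ τ t} →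
              O ⊢ f (top (lookup σ i)) , σ ⇓ τ ⟨ t ⟩ →
              O ⊢ branch i f , σ ⇓ τ ⟨ suc t ⟩
  while-end : ∀ {i c σ} → lookup σ i ≡ [] →
              O ⊢ while i c , σ ⇓ σ ⟨ 1 ⟩
  while-run : ∀ {i c σ τ υ s t} → lookup σ i ≢ [] →
              O ⊢ c , σ ⇓ τ ⟨ s ⟩ → O ⊢ while i c , τ ⇓ υ ⟨ t ⟩ →
              O ⊢ while i c , σ ⇓ υ ⟨ suc (s ℕ.+ t) ⟩

-- Second-order polynomials in the input length n and the oracle's length
-- function b (Kapron–Cook).  Answers of a function oracle may be arbitrarily
-- long, so this is what "polynomial time" means relative to such an oracle;
-- if b is a polynomial then ⟦ p ⟧ b is an ordinary polynomial in n.
data Poly₂ : Set where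
  const   : ℕ → Poly₂
  size    : Poly₂
  _⊕_ _⊗_ : Poly₂ → Poly₂ → Poly₂
  answer  : Poly₂ → Poly₂

⟦_⟧ : Poly₂ → (ℕ → ℕ) → ℕ → ℕ
⟦ const c  ⟧ b n = c
⟦ size     ⟧ b n = n
⟦ p ⊕ q    ⟧ b n = ⟦ p ⟧ b n ℕ.+ ⟦ q ⟧ b n
⟦ p ⊗ q    ⟧ b n = ⟦ p ⟧ b n ℕ.* ⟦ q ⟧ b n
⟦ answer p ⟧ b n = b (⟦ p ⟧ b n)

LengthBound : (Word → Word) → (ℕ → ℕ) → Set
LengthBound O b = ∀ {n} w → length w ≤ n → length (O w) ≤ b n

record DecisionProblem : Set₁ where
  field
    Instance : Set
    encode   : Instance → Word
    Yes      : Instance → Set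

record FunctionProblem : Set₁ where
  field
    Input        : Set
    Output       : Set
    encodeInput  : Input → Word
    encodeOutput : Output → Word
    compute      : Input → Output

-- An oracle for a function problem may answer arbitrarily to words that do
-- not encode an input.
Solves : (Word → Word) → FunctionProblem → Set
Solves O F = ∀ x → O (encodeInput x) ≡ encodeOutput (compute x)
  where open FunctionProblem F

-- Polynomial-time Turing reducibility.  The input is on stack 0, all other
-- stacks being empty, and the answer is the only letter on stack 0 at the end.
infix 4 _≤ᵖᵀ_
_≤ᵖᵀ_ : DecisionProblem → FunctionProblem → Set
D ≤ᵖᵀ F =
  ∃[ k ] ∃ λ (c : Program (suc k)) → ∃ λ (p : Poly₂) →
    ∀ O → Solves O F → ∀ b → LengthBound O b → ∀ x →
    ∃[ σ ] ∃[ t ] ∃[ yes? ]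
      (O ⊢ c , (encode x ∷ replicate k []) ⇓ σ ⟨ t ⟩) ×
      t ≤ ⟦ p ⟧ b (length (encode x)) ×
      lookup σ zero ≡ [ bit yes? ] ×
      Reflects (Yes x) yes?
  where open DecisionProblem D

GraphIsomorphism : DecisionProblem
GraphIsomorphism = record
  { Instance = Graph × Graph
  ; encode   = λ (G , H) → encodeGraph G ++ comma ∷ encodeGraph H
  ; Yes      = λ (G , H) → G ≅ H
  }

Computing : ∀ 𝒮 → (List (Logic.Formula 𝒮) → List (Logic.Formula 𝒮)) → FunctionProblem
Computing 𝒮 N = record
  { Input        = List Formula
  ; Output       = List Formula
  ; encodeInput  = encodeFormulas
  ; encodeOutput = encodeFormulas
  ; compute      = N
  }
  where open Logic 𝒮

{-# OPTIONS --safe #-}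

-- Encode a graph by one formula per entry of its adjacency matrix, over free
-- predicate symbols only: E(x_u, x_v) if u and v are adjacent, and the nullary
-- x_u if not.  No operator is commutative here, so a list of formulas X
-- describes G if it is, up to order, this encoding for some choice of E and of
-- distinct names x_u.
--   * If X describes G, so does N(X), being a shuffled and renamed copy of X.
--   * If X and Y describe the same graph, they have the same patterns.
--   * A list describes at most one graph up to isomorphism, and it describes
--     all graphs isomorphic to that one.
-- N(X) is always of the form R(M) with M a pattern, which makes condition (2)
-- applicable to it although V may be such that no suitable renaming can be
-- computed.  Hence N(N(X)) = N(N(Y)) if and only if X and Y describe
-- isomorphic graphs, and two pairs of nested queries decide isomorphism.

module Submission where

open import Defs
open import Data.Bool.Base using (Bool; true; false; if_then_else_)
open import Data.Empty using (⊥; ⊥-elim)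
open import Data.Fin.Base using (Fin; zero; suc; toℕ)
open import Data.Fin.Patterns
open import Data.Fin.Properties using (any?; toℕ-injective)
open import Data.List.Base
  using (List; []; _∷_; [_]; _++_; _ʳ++_; map; concat; concatMap; mapMaybe; length; null; reverse;
         filter; takeWhile; deduplicate; tabulate; allFin; cartesianProduct; replicate)
open import Data.List.Membership.Propositional using () renaming (_∈_ to _∈ˡ_)
open import Data.List.Membership.Propositional.Properties
  using (∈-++⁺ˡ; ∈-++⁺ʳ; ∈-map⁺; ∈-map⁻; ∈-allFin; ∈-cartesianProduct⁺)
open import Data.List.Membership.Propositional.Properties.WithK using (unique∧set⇒bag)
open import Data.List.Properties
open import Data.List.Relation.Binary.BagAndSetEquality using (∼bag⇒↭)
open import Data.List.Relation.Binary.Permutation.Propositional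
  using (_↭_; ↭-refl; ↭-sym; ↭-trans; ↭-reflexive)
open import Data.List.Relation.Binary.Permutation.Propositional.Properties
  using (All-resp-↭; ∈-resp-↭; shift; shifts) renaming (map⁺ to ↭-map⁺; ++⁺ˡ to ↭-++⁺ˡ)
open import Data.List.Relation.Binary.Pointwise using (Pointwise; []; _∷_)
open import Data.List.Relation.Unary.All as All using (All; []; _∷_)
import Data.List.Relation.Unary.All.Properties as All
open import Data.List.Relation.Unary.Any using (here; there)
open import Data.List.Relation.Unary.Unique.Propositional using (Unique)
import Data.List.Relation.Unary.Unique.Propositional.Properties as Unique
open import Data.Maybe.Base using (Maybe; just; nothing)
import Data.Maybe.Properties as Maybe
open import Data.Nat.Base using (ℕ; zero; suc; _+_; _*_; _≤_; z≤n; s≤s)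
open import Data.Nat.Binary.Base using (zero; 2[1+_]; 1+[2_]; fromℕ) renaming (toℕ to ℕᵇ-toℕ)
open import Data.Nat.Binary.Properties using (fromℕ-toℕ; toℕ-fromℕ; fromℕ-injective)
open import Data.Nat.Properties
  using (suc-injective; 0≢1+n; 1+n≢0; +-comm; +-assoc; +-suc; +-identityʳ; *-distribʳ-+;
         ≤-refl; ≤-reflexive; ≤-trans; <⇒≤; n≤1+n; m≤m+n; m≤n+m; m≤m*n; m≤n⇒m≤1+n;
         m+n≤o⇒m≤o; m+n≤o⇒n≤o; +-mono-≤; +-monoˡ-≤; +-monoʳ-≤; *-monoˡ-≤; *-monoʳ-≤; module ≤-Reasoning)
  renaming (_≟_ to _≟ⁿ_)
open import Data.Product.Base using (_×_; _,_; ∃-syntax; proj₁; proj₂)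
open import Data.Product.Properties using (,-injectiveˡ; ,-injectiveʳ)
open import Data.Unit.Base using (⊤; tt)
import Data.Vec.Base as Vec
open import Data.Vec.Base using ([]; _∷_)
open import Function.Base using (_∘_; id)
open import Function.Bundles using (Injection; Inverse; _↔_; mk↔ₛ′; mk⇔; mk↣)
open import Function.Properties.Inverse using (↔-sym)
open import Level using (0ℓ)
open import Relation.Binary.Definitions using (DecidableEquality)
open import Relation.Binary.PropositionalEquality
  using (_≡_; _≢_; refl; sym; trans; cong; cong₂; subst; subst₂; module ≡-Reasoning)
open import Relation.Nullary
  using (¬_; Dec; yes; no; does; Reflects; ofʸ; ofⁿ; ¬?; _×-dec_)
open import Relation.Nullary.Decidable using (dec-true; dec-false; via-injection)
open import Relation.Unary using (Pred; _∈_; Decidable)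

open Graph

-- Decidable equality of letters

_≟ˡ_ : DecidableEquality Letter
_≟ˡ_ = via-injection (mk↣ to-injective) _≟ⁿ_
  where
  to : Letter → ℕ
  to (bit false) = 0
  to (bit true)  = 1
  to comma       = 2
  to semi        = 3
  to tagTheory   = 4
  to tagUser     = 5
  to tagPat      = 6

  from : ℕ → Letter
  from 0 = bit false
  from 1 = bit true
  from 2 = comma
  from 3 = semi
  from 4 = tagTheory
  from 5 = tagUser
  from _ = tagPat

  from∘to : ∀ a → from (to a) ≡ a
  from∘to (bit false) = refl
  from∘to (bit true)  = refl
  from∘to comma       = refl
  from∘to semi        = refl
  from∘to tagTheory   = refl
  from∘to tagUser     = refl
  from∘to tagPat      = refl

  to-injective : ∀ {a b} → to a ≡ to b → a ≡ b
  to-injective {a} {b} eq = trans (sym (from∘to a)) (trans (cong from eq) (from∘to b))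

-- The machine

encodeRows : List Bits → Word
encodeRows = concatMap (λ row → bits row ++ [ semi ])

-- Row and column counters are kept as tallies, so that a counter is itself the name of a vertex and
-- writing a name amounts to copying a stack.
tally : ℕ → Word
tally n = bits (replicate n true)

length-tally : ∀ n → length (tally n) ≡ n
length-tally n = trans (length-map bit (replicate n true)) (length-replicate n)

tally-shift : ∀ n w → tally n ++ bit true ∷ w ≡ bit true ∷ tally n ++ w
tally-shift zero    w = refl
tally-shift (suc n) w = cong (bit true ∷_) (tally-shift n w)

-- `edge` encodes the symbol E, and `head` is the part of the encoding of x_u
-- that comes before its name.  Names are written in unary: x_u is named 1^u.
module Machine (head edge : Word) where

  variableWord : ℕ → Word
  variableWord u = head ++ tally u ++ [ semi ]

  cellWord : Bool → ℕ → ℕ → Word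
  cellWord true  u v = edge ++ variableWord u ++ variableWord v ++ [ semi ]
  cellWord false u v = variableWord u ++ [ semi ]

  -- Later cells land in front of earlier ones, as on a stack. The resulting reversal is harmless
  -- because `Describes` is up to permutation.
  rowWord : ℕ → ℕ → Bits → Word → Word
  rowWord u v []       out = out
  rowWord u v (b ∷ bs) out = rowWord u (suc v) bs (cellWord b u v ++ out)

  tableWord : ℕ → List Bits → Word → Word
  tableWord u []         out = out
  tableWord u (bs ∷ bss) out = tableWord (suc u) bss (rowWord u 0 bs out)

  -- `row` and `column` count in unary, `spare` is the buffer for copying a counter and later
  -- receives the second answer, and `saved` keeps the first answer.
  input output row column spare saved : Fin 6
  input  = 0F
  output = 1F
  row    = 2F
  column = 3F
  spare  = 4F
  saved  = 5F

  erase : Fin 6 → Program 6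
  erase i = while i (pop i)

  transfer : Fin 6 → Maybe Letter → Fin 6 → Program 6
  transfer i nothing  j = skip
  transfer i (just a) j = pop i ⨟ push a j

  unload : Fin 6 → Fin 6 → Program 6
  unload i j = while i (branch i λ a → transfer i a j)

  duplicate : Fin 6 → Program 6
  duplicate i =
    while i (pop i ⨟ push (bit true) spare ⨟ push (bit true) output) ⨟ unload spare i

  write : Word → Program 6
  write []      = skip
  write (a ∷ w) = write w ⨟ push a output

  writeVariable : Fin 6 → Program 6
  writeVariable i = push semi output ⨟ duplicate i ⨟ write head

  writeCell : Bool → Program 6
  writeCell true  = push semi output ⨟ writeVariable column ⨟ writeVariable row ⨟ write edge
  writeCell false = push semi output ⨟ writeVariable row

  consult : Program 6
  consult = query output ⨟ query output

  step : Maybe Letter → Program 6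
  step (just (bit b)) = pop input ⨟ writeCell b ⨟ push (bit true) column
  step (just semi)    = pop input ⨟ erase column ⨟ push (bit true) row
  -- Between the two matrices the first answer is put aside, leaving `output` and `row` empty again;
  -- `column` starts empty and is erased at the end of each row.
  step (just comma)   = pop input ⨟ consult ⨟ unload output saved ⨟ erase row
  -- Never reached: no other letter occurs in an encoded instance, and the loop test excludes
  -- `nothing`.
  step _              = skip

  translate : Program 6
  translate = while input (branch input step)

  match : Maybe Letter → Maybe Letter → Program 6
  match a b =
    if does (Maybe.≡-dec _≟ˡ_ a b)
    then pop saved ⨟ pop spare
    -- Emptying `saved` stops the loop, and the `comma` keeps `spare` nonempty even if it was
    -- already exhausted.
    else erase saved ⨟ push comma spare

  compare : Program 6
  compare = while saved (branch saved λ a → branch spare λ b → match a b)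

  accept : Maybe Letter → Program 6
  accept nothing  = push (bit true) input
  accept (just _) = push (bit false) input

  program : Program 6
  program = translate ⨟ consult ⨟ unload output spare ⨟ compare ⨟ branch spare accept

  -- In the first three, `size` stands for a bound on the row and column
  -- indices; in the others it is the length of the input.
  variableCost cellCost stepCost outputSize answerSize consultCost commaCost totalCost : Poly₂
  variableCost = const 1 ⊕ (((const 1 ⊕ (size ⊗ const 4)) ⊕ (const 1 ⊕ (size ⊗ const 4)))
                   ⊕ const (suc (length head)))
  cellCost     = const 1 ⊕ (variableCost ⊕ (variableCost ⊕ const (suc (length edge))))
  stepCost     = const 5 ⊕ ((size ⊗ const 2) ⊕ cellCost)
  outputSize   = size ⊗ cellCost
  answerSize   = answer (answer outputSize)
  consultCost  = (const 1 ⊕ answer outputSize) ⊕ (const 1 ⊕ answerSize)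
  commaCost    = const 3 ⊕ (consultCost ⊕ ((const 1 ⊕ (answerSize ⊗ const 4)) ⊕ (const 1 ⊕ (size ⊗ const 2))))
  totalCost    =
    ((size ⊗ stepCost) ⊕ (commaCost ⊕ ((size ⊗ stepCost) ⊕ const 1))) ⊕
    (consultCost ⊕ ((const 1 ⊕ (answerSize ⊗ const 4)) ⊕ ((const 4 ⊕ (answerSize ⊗ const 5)) ⊕ const 2)))

  -- Correctness and running time of the program

  module _ (O : Word → Word) where

    infix 3 _,_⇓_⟨_⟩ _,_⇓_within_
    _,_⇓_⟨_⟩ _,_⇓_within_ : Program 6 → Store 6 → Store 6 → ℕ → Set
    c , σ ⇓ τ ⟨ t ⟩ = O ⊢ c , σ ⇓ τ ⟨ t ⟩
    c , σ ⇓ τ within n = ∃[ t ] (c , σ ⇓ τ ⟨ t ⟩) × t ≤ n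

    infixr 5 _⨾_
    _⨾_ : ∀ {c d σ τ υ m n} →
          c , σ ⇓ τ within m → d , τ ⇓ υ within n → c ⨟ d , σ ⇓ υ within m + n
    (_ , p , s≤m) ⨾ (_ , q , t≤n) = _ , (p ⨟ q) , +-mono-≤ s≤m t≤n

    exactly : ∀ {c σ τ t} → c , σ ⇓ τ ⟨ t ⟩ → c , σ ⇓ τ within t
    exactly p = _ , p , ≤-refl

    relax : ∀ {c σ τ m n} → m ≤ n → c , σ ⇓ τ within m → c , σ ⇓ τ within n
    relax m≤n (_ , p , t≤m) = _ , p , ≤-trans t≤m m≤n

    -- The two extra steps are the loop test and the branch on the letter read.
    iterate-translate : ∀ {a w o r c t s τ υ m n} →
      let σ = (a ∷ w) ∷ o ∷ r ∷ c ∷ t ∷ s ∷ [] in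
      step (just a) , σ ⇓ τ within m → translate , τ ⇓ υ within n →
      translate , σ ⇓ υ within suc (suc m) + n
    iterate-translate (_ , p , s≤m) (_ , q , t≤n) =
      _ , while-run (λ ()) (branch p) q , s≤s (s≤s (+-mono-≤ s≤m t≤n))

    private variable
      x o r c t s : Word

    -- Runs are stated for each concrete stack separately, so that lookups and updates of the store
    -- compute by themselves. A letter costs two steps, the test and the `pop`.
    erase-row : ∀ w → erase row , x ∷ o ∷ w ∷ c ∷ t ∷ s ∷ [] ⇓ x ∷ o ∷ [] ∷ c ∷ t ∷ s ∷ []
                  ⟨ suc (length w * 2) ⟩
    erase-row []      = while-end refl
    erase-row (_ ∷ w) = while-run (λ ()) pop (erase-row w)

    erase-column : ∀ w → erase column , x ∷ o ∷ r ∷ w ∷ t ∷ s ∷ [] ⇓ x ∷ o ∷ r ∷ [] ∷ t ∷ s ∷ []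
                     ⟨ suc (length w * 2) ⟩
    erase-column []      = while-end refl
    erase-column (_ ∷ w) = while-run (λ ()) pop (erase-column w)

    erase-saved : ∀ w → erase saved , x ∷ o ∷ r ∷ c ∷ t ∷ w ∷ [] ⇓ x ∷ o ∷ r ∷ c ∷ t ∷ [] ∷ []
                    ⟨ suc (length w * 2) ⟩
    erase-saved []      = while-end refl
    erase-saved (_ ∷ w) = while-run (λ ()) pop (erase-saved w)

    -- Four steps per letter: test, branch, `pop`, `push`.
    unload-output-saved : ∀ w {s} →
      unload output saved , x ∷ w ∷ r ∷ c ∷ t ∷ s ∷ [] ⇓ x ∷ [] ∷ r ∷ c ∷ t ∷ (w ʳ++ s) ∷ []
        ⟨ suc (length w * 4) ⟩
    unload-output-saved []      = while-end refl
    unload-output-saved (_ ∷ w) = while-run (λ ()) (branch (pop ⨟ push)) (unload-output-saved w)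

    unload-output-spare : ∀ w {t} →
      unload output spare , x ∷ w ∷ r ∷ c ∷ t ∷ s ∷ [] ⇓ x ∷ [] ∷ r ∷ c ∷ (w ʳ++ t) ∷ s ∷ []
        ⟨ suc (length w * 4) ⟩
    unload-output-spare []      = while-end refl
    unload-output-spare (_ ∷ w) = while-run (λ ()) (branch (pop ⨟ push)) (unload-output-spare w)

    duplicate-row : ∀ u {o} →
      duplicate row , x ∷ o ∷ tally u ∷ c ∷ [] ∷ s ∷ [] ⇓
        x ∷ (tally u ++ o) ∷ tally u ∷ c ∷ [] ∷ s ∷ [] ⟨ suc (u * 4) + suc (u * 4) ⟩
    duplicate-row u = spread u ⨟ restore u (++-identityʳ (tally u))
      where
      spread : ∀ u {o t} →
        while row (pop row ⨟ push (bit true) spare ⨟ push (bit true) output) ,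
          x ∷ o ∷ tally u ∷ c ∷ t ∷ s ∷ [] ⇓ x ∷ (tally u ++ o) ∷ [] ∷ c ∷ (tally u ++ t) ∷ s ∷ []
          ⟨ suc (u * 4) ⟩
      spread zero = while-end refl
      -- The bit to be moved is shifted behind the tally, where the induction hypothesis finds it
      -- already on the target stacks.
      spread (suc u) {o} {t} rewrite sym (tally-shift u o) | sym (tally-shift u t) =
        while-run (λ ()) (pop ⨟ push ⨟ push) (spread u)

      restore : ∀ u {w w′} → tally u ++ w ≡ w′ →
        unload spare row , x ∷ o ∷ w ∷ c ∷ (tally u ++ []) ∷ s ∷ [] ⇓ x ∷ o ∷ w′ ∷ c ∷ [] ∷ s ∷ []
          ⟨ suc (u * 4) ⟩
      restore zero    refl = while-end refl
      restore (suc u) eq   =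
        while-run (λ ()) (branch (pop ⨟ push)) (restore u (trans (tally-shift u _) eq))

    duplicate-column : ∀ v {o} →
      duplicate column , x ∷ o ∷ r ∷ tally v ∷ [] ∷ s ∷ [] ⇓
        x ∷ (tally v ++ o) ∷ r ∷ tally v ∷ [] ∷ s ∷ [] ⟨ suc (v * 4) + suc (v * 4) ⟩
    duplicate-column v = spread v ⨟ restore v (++-identityʳ (tally v))
      where
      spread : ∀ v {o t} →
        while column (pop column ⨟ push (bit true) spare ⨟ push (bit true) output) ,
          x ∷ o ∷ r ∷ tally v ∷ t ∷ s ∷ [] ⇓ x ∷ (tally v ++ o) ∷ r ∷ [] ∷ (tally v ++ t) ∷ s ∷ []
          ⟨ suc (v * 4) ⟩
      spread zero = while-end refl
      spread (suc v) {o} {t} rewrite sym (tally-shift v o) | sym (tally-shift v t) =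
        while-run (λ ()) (pop ⨟ push ⨟ push) (spread v)

      restore : ∀ v {w w′} → tally v ++ w ≡ w′ →
        unload spare column , x ∷ o ∷ r ∷ w ∷ (tally v ++ []) ∷ s ∷ [] ⇓ x ∷ o ∷ r ∷ w′ ∷ [] ∷ s ∷ []
          ⟨ suc (v * 4) ⟩
      restore zero    refl = while-end refl
      restore (suc v) eq   =
        while-run (λ ()) (branch (pop ⨟ push)) (restore v (trans (tally-shift v _) eq))

    write-word : ∀ w → write w , x ∷ o ∷ r ∷ c ∷ t ∷ s ∷ [] ⇓ x ∷ (w ++ o) ∷ r ∷ c ∷ t ∷ s ∷ []
                         within suc (length w)
    write-word []      = exactly skip
    write-word (a ∷ w) = relax (≤-reflexive (+-comm _ 1)) (write-word w ⨾ exactly push)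

    module _ (b : ℕ → ℕ) where

      private
        index-mono : ∀ {u n} → u ≤ n → suc (u * 4) + suc (u * 4) ≤ suc (n * 4) + suc (n * 4)
        index-mono u≤n = +-mono-≤ (s≤s (*-monoˡ-≤ 4 u≤n)) (s≤s (*-monoˡ-≤ 4 u≤n))

        spell : ∀ w u o → w ++ tally u ++ semi ∷ o ≡ (w ++ tally u ++ [ semi ]) ++ o
        spell w u o = sym (trans (++-assoc w _ o) (cong (w ++_) (++-assoc (tally u) [ semi ] o)))

      -- The word is built from its end, since the top of the stack is its beginning: first `semi`,
      -- then the copied tally, then `head`.
      write-row-variable : ∀ {u n} → u ≤ n →
        writeVariable row , x ∷ o ∷ tally u ∷ c ∷ [] ∷ s ∷ [] ⇓
          x ∷ (variableWord u ++ o) ∷ tally u ∷ c ∷ [] ∷ s ∷ [] within ⟦ variableCost ⟧ b n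
      write-row-variable {o = o} {u = u} u≤n rewrite sym (spell head u o) =
        exactly push ⨾ relax (index-mono u≤n) (exactly (duplicate-row u)) ⨾ write-word head

      write-column-variable : ∀ {v n} → v ≤ n →
        writeVariable column , x ∷ o ∷ r ∷ tally v ∷ [] ∷ s ∷ [] ⇓
          x ∷ (variableWord v ++ o) ∷ r ∷ tally v ∷ [] ∷ s ∷ [] within ⟦ variableCost ⟧ b n
      write-column-variable {o = o} {v = v} v≤n rewrite sym (spell head v o) =
        exactly push ⨾ relax (index-mono v≤n) (exactly (duplicate-column v)) ⨾ write-word head

      write-cell : ∀ a {u v n} → u ≤ n → v ≤ n →
        writeCell a , x ∷ o ∷ tally u ∷ tally v ∷ [] ∷ s ∷ [] ⇓
          x ∷ (cellWord a u v ++ o) ∷ tally u ∷ tally v ∷ [] ∷ s ∷ [] within ⟦ cellCost ⟧ b n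
      write-cell {o = o} true {u} {v} u≤n v≤n
        rewrite ++-assoc edge (variableWord u ++ variableWord v ++ [ semi ]) o
              | ++-assoc (variableWord u) (variableWord v ++ [ semi ]) o
              | ++-assoc (variableWord v) [ semi ] o =
        exactly push ⨾ write-column-variable v≤n ⨾ write-row-variable u≤n ⨾ write-word edge
      write-cell {o = o} false {u} {n = n} u≤n v≤n
        rewrite ++-assoc (variableWord u) [ semi ] o =
        relax (s≤s (m≤m+n (⟦ variableCost ⟧ b n) _)) (exactly push ⨾ write-row-variable u≤n)

    match-yes : ∀ {a b σ τ n} → a ≡ b →
      pop saved ⨟ pop spare , σ ⇓ τ ⟨ n ⟩ → match a b , σ ⇓ τ ⟨ n ⟩
    match-yes {a} {b} a≡b p rewrite dec-true (Maybe.≡-dec _≟ˡ_ a b) a≡b = p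

    match-no : ∀ {a b σ τ n} → a ≢ b →
      erase saved ⨟ push comma spare , σ ⇓ τ ⟨ n ⟩ → match a b , σ ⇓ τ ⟨ n ⟩
    match-no {a} {b} a≢b p rewrite dec-false (Maybe.≡-dec _≟ˡ_ a b) a≢b = p

    -- A match costs five steps: the test, two branches and two pops. `spare` ends up empty only if
    -- both words run out together: a longer `w` leaves a remainder, and a mismatch leaves at least
    -- the `comma`.
    compare-words : ∀ v w → ∃[ z ]
      (compare , x ∷ o ∷ r ∷ c ∷ w ∷ v ∷ [] ⇓ x ∷ o ∷ r ∷ c ∷ z ∷ [] ∷ [] within 4 + length v * 5) ×
      Reflects (v ≡ w) (null z)
    compare-words [] []      = [] , (_ , while-end refl , s≤s z≤n) , ofʸ refl
    compare-words [] (b ∷ w) = b ∷ w , (_ , while-end refl , s≤s z≤n) , ofⁿ λ ()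
    compare-words (a ∷ v) w with Maybe.≡-dec _≟ˡ_ (just a) (top w)
    compare-words (a ∷ v) (_ ∷ w) | yes refl =
      let z , (_ , p , t≤) , v≡w? = compare-words v w in
      z , (_ , while-run (λ ()) (branch (branch (match-yes {just a} refl (pop ⨟ pop)))) p , +-monoʳ-≤ 5 t≤) ,
      ∷-reflects v≡w?
      where
      ∷-reflects : ∀ {y} → Reflects (v ≡ w) y → Reflects (a ∷ v ≡ a ∷ w) y
      ∷-reflects (ofʸ v≡w) = ofʸ (cong (a ∷_) v≡w)
      ∷-reflects (ofⁿ v≢w) = ofⁿ (v≢w ∘ ∷-injectiveʳ)
    ... | no a≢ =
      comma ∷ w ,
      (_ , while-run (λ ()) (branch (branch (match-no a≢ (erase-saved (a ∷ v) ⨟ push)))) (while-end refl) ,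
       +-monoʳ-≤ 6 short) ,
      ofⁿ λ { refl → a≢ refl }
      where
      open ≤-Reasoning
      -- After a mismatch the rest of `saved` is erased at two steps per letter, less than the five
      -- allotted for comparing it.
      short : (length v * 2 + 1) + 1 ≤ 3 + length v * 5
      short = begin
        (length v * 2 + 1) + 1 ≡⟨ trans (+-assoc (length v * 2) 1 1) (+-comm _ 2) ⟩
        2 + length v * 2       ≤⟨ +-mono-≤ (m≤m+n 2 1) (*-monoʳ-≤ (length v) (m≤m+n 2 3)) ⟩
        3 + length v * 5       ∎

    -- Bounds for translating and consulting on inputs of length at most `L`

    module _ {b : ℕ → ℕ} (bounded : LengthBound O b) (L : ℕ) where

      private
        S Q A : ℕ
        S = ⟦ stepCost ⟧ b L
        Q = ⟦ outputSize ⟧ b L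
        A = ⟦ answerSize ⟧ b L

      -- The remaining run is passed as a continuation, so that bounds accumulate as the loop
      -- unfolds forwards. It only learns that the final column index is at most `L`, which is
      -- enough to bound the erasure that follows.
      translate-row : ∀ bs {u v x o s τ T} → u ≤ L → v + length bs ≤ L →
        (∀ {v′} → v′ ≤ L →
         translate , x ∷ rowWord u v bs o ∷ tally u ∷ tally v′ ∷ [] ∷ s ∷ [] ⇓ τ within T) →
        translate , (bits bs ++ x) ∷ o ∷ tally u ∷ tally v ∷ [] ∷ s ∷ [] ⇓ τ within length bs * S + T
      translate-row [] {v = v} _ v≤L k rewrite +-identityʳ v = k v≤L
      translate-row (a ∷ bs) {v = v} {T = T} u≤L v≤L k rewrite +-suc v (length bs) =
        relax (≤-trans (+-monoˡ-≤ _ step≤S) (≤-reflexive (sym (+-assoc S _ T))))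
          (iterate-translate (exactly pop ⨾ write-cell b a u≤L (≤-trans (m≤m+n v _) (<⇒≤ v≤L)) ⨾ exactly push)
            (translate-row bs u≤L v≤L k))
        where
        -- The loop test, the branch and the `pop` come before the cell, the push onto `column`
        -- after it.
        step≤S : 3 + (⟦ cellCost ⟧ b L + 1) ≤ S
        step≤S = +-monoʳ-≤ 3 (≤-trans (≤-reflexive (+-comm (⟦ cellCost ⟧ b L) 1))
                                      (s≤s (m≤n⇒m≤1+n (m≤n+m _ (L * 2)))))

      length-encodeRows : ∀ bs bss →
        length (encodeRows (bs ∷ bss)) ≡ length bs + suc (length (encodeRows bss))
      length-encodeRows bs bss
        rewrite ++-assoc (bits bs) [ semi ] (encodeRows bss)
              | length-++ (bits bs) {semi ∷ encodeRows bss}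
              | length-map bit bs = refl

      -- Each row uses up at least its `semi`, so the row index grows no faster than the input
      -- shrinks. Their sum staying below `L` is the invariant that bounds both counters.
      row-fits : ∀ {u} bs bss → u + length (encodeRows (bs ∷ bss)) ≤ L →
                 u ≤ L × length bs ≤ L × suc u + length (encodeRows bss) ≤ L
      row-fits {u} bs bss fits rewrite length-encodeRows bs bss =
        m+n≤o⇒m≤o u fits ,
        m+n≤o⇒m≤o (length bs) (m+n≤o⇒n≤o u fits) ,
        ≤-trans (≤-reflexive (sym (+-suc u _))) (≤-trans (+-monoʳ-≤ u (m≤n+m _ (length bs))) fits)

      translate-table : ∀ bss {u x o s τ T} → u + length (encodeRows bss) ≤ L →
        (u + length bss ≤ L →
         translate , x ∷ tableWord u bss o ∷ tally (u + length bss) ∷ [] ∷ [] ∷ s ∷ [] ⇓ τ within T) →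
        translate , (encodeRows bss ++ x) ∷ o ∷ tally u ∷ [] ∷ [] ∷ s ∷ [] ⇓ τ
          within length (encodeRows bss) * S + T
      translate-table [] {u} u≤L k rewrite +-identityʳ u = k u≤L
      translate-table (bs ∷ bss) {u} {x} {τ = τ} {T} fits k
        rewrite +-suc u (length bss)
              | trans (++-assoc (bits bs ++ [ semi ]) (encodeRows bss) x)
                      (++-assoc (bits bs) [ semi ] (encodeRows bss ++ x)) =
        let u≤L , bs≤L , fits′ = row-fits bs bss fits in
        relax (≤-reflexive sum≡)
          (translate-row bs u≤L bs≤L λ {v} v≤L →
            relax (+-monoˡ-≤ _ (step≤S v≤L))
              (iterate-translate
                (exactly pop ⨾ exactly (erase-column (tally v)) ⨾ exactly push)
                (translate-table bss fits′ k)))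
        where
        n = length (encodeRows bss)

        -- `stepCost` also covers the letter `semi`: its summand `size ⊗ const 2` pays for erasing
        -- `column`.
        step≤S : ∀ {v} → v ≤ L → 3 + (suc (length (tally v) * 2) + 1) ≤ S
        step≤S {v} v≤L rewrite length-tally v =
          +-monoʳ-≤ 4 (≤-trans (≤-reflexive (+-comm (v * 2) 1))
                               (s≤s (≤-trans (*-monoˡ-≤ 2 v≤L) (m≤m+n _ _))))

        sum≡ : length bs * S + (S + (n * S + T)) ≡ length (encodeRows (bs ∷ bss)) * S + T
        sum≡ = begin
          length bs * S + (S + (n * S + T))        ≡⟨ cong (length bs * S +_) (sym (+-assoc S _ T)) ⟩
          length bs * S + (suc n * S + T)          ≡⟨ sym (+-assoc (length bs * S) _ T) ⟩
          length bs * S + suc n * S + T            ≡⟨ cong (_+ T) (sym (*-distribʳ-+ S (length bs) (suc n))) ⟩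
          (length bs + suc n) * S + T              ≡⟨ cong (λ m → m * S + T) (sym (length-encodeRows bs bss)) ⟩
          length (encodeRows (bs ∷ bss)) * S + T   ∎
          where open ≡-Reasoning

      -- Writing a letter costs at least one step, so the cost of writing a word doubles as a bound
      -- on its length, and hence on the size of the queries.
      length-variableWord : ∀ {u} → u ≤ L → length (variableWord u) ≤ ⟦ variableCost ⟧ b L
      length-variableWord {u} u≤L
        rewrite length-++ head {tally u ++ [ semi ]} | length-++ (tally u) {[ semi ]} | length-tally u = begin
          length head + (u + 1)                            ≡⟨ +-comm (length head) _ ⟩
          u + 1 + length head                              ≡⟨ +-assoc u 1 _ ⟩
          u + suc (length head)                            ≤⟨ +-monoˡ-≤ (suc (length head)) u≤ ⟩
          (suc (L * 4) + suc (L * 4)) + suc (length head)  ≤⟨ n≤1+n _ ⟩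
          ⟦ variableCost ⟧ b L                             ∎
        where
        open ≤-Reasoning
        u≤ : u ≤ suc (L * 4) + suc (L * 4)
        u≤ = ≤-trans u≤L (≤-trans (m≤m*n L 4) (≤-trans (n≤1+n _) (m≤m+n _ _)))

      length-cellWord : ∀ a {u v} → u ≤ L → v ≤ L → length (cellWord a u v) ≤ ⟦ cellCost ⟧ b L
      length-cellWord true {u} {v} u≤L v≤L
        rewrite length-++ edge {variableWord u ++ variableWord v ++ [ semi ]}
              | length-++ (variableWord u) {variableWord v ++ [ semi ]}
              | length-++ (variableWord v) {[ semi ]} = begin
          e + (length (variableWord u) + (length (variableWord v) + 1))
            ≤⟨ +-monoʳ-≤ e (+-mono-≤ (length-variableWord u≤L) (+-monoˡ-≤ 1 (length-variableWord v≤L))) ⟩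
          e + (V + (V + 1))     ≡⟨ +-comm e _ ⟩
          V + (V + 1) + e       ≡⟨ +-assoc V _ e ⟩
          V + ((V + 1) + e)     ≡⟨ cong (V +_) (+-assoc V 1 e) ⟩
          V + (V + suc e)       ≤⟨ n≤1+n _ ⟩
          ⟦ cellCost ⟧ b L      ∎
        where
        open ≤-Reasoning
        e = length edge
        V = ⟦ variableCost ⟧ b L
      length-cellWord false {u} u≤L v≤L rewrite length-++ (variableWord u) {[ semi ]} = begin
          length (variableWord u) + 1  ≤⟨ +-monoˡ-≤ 1 (length-variableWord u≤L) ⟩
          V + 1                        ≡⟨ +-comm V 1 ⟩
          suc V                        ≤⟨ s≤s (m≤m+n V _) ⟩
          ⟦ cellCost ⟧ b L             ∎
        where
        open ≤-Reasoning
        V = ⟦ variableCost ⟧ b L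

      length-rowWord : ∀ bs {u v o} → u ≤ L → v + length bs ≤ L →
        length (rowWord u v bs o) ≤ length bs * ⟦ cellCost ⟧ b L + length o
      length-rowWord [] _ _ = ≤-refl
      length-rowWord (a ∷ bs) {u} {v} {o} u≤L v≤L rewrite +-suc v (length bs) = begin
        length (rowWord u (suc v) bs (cellWord a u v ++ o))  ≤⟨ length-rowWord bs u≤L v≤L ⟩
        length bs * C + length (cellWord a u v ++ o)         ≡⟨ cong (length bs * C +_) (length-++ (cellWord a u v)) ⟩
        length bs * C + (length (cellWord a u v) + length o) ≤⟨ +-monoʳ-≤ (length bs * C) (+-monoˡ-≤ (length o)
                                                                  (length-cellWord a u≤L (≤-trans (m≤m+n v _) (<⇒≤ v≤L)))) ⟩
        length bs * C + (C + length o)                       ≡⟨ sym (+-assoc (length bs * C) C _) ⟩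
        length bs * C + C + length o                         ≡⟨ cong (_+ length o) (+-comm (length bs * C) C) ⟩
        C + length bs * C + length o                         ∎
        where
        open ≤-Reasoning
        C = ⟦ cellCost ⟧ b L

      length-tableWord : ∀ bss {u o} → u + length (encodeRows bss) ≤ L →
        length (tableWord u bss o) ≤ length (encodeRows bss) * ⟦ cellCost ⟧ b L + length o
      length-tableWord [] _ = ≤-refl
      length-tableWord (bs ∷ bss) {u} {o} fits with row-fits bs bss fits
      ... | u≤L , bs≤L , fits′ rewrite length-encodeRows bs bss = begin
        length (tableWord (suc u) bss (rowWord u 0 bs o))  ≤⟨ length-tableWord bss fits′ ⟩
        n * C + length (rowWord u 0 bs o)                  ≤⟨ +-monoʳ-≤ (n * C) (length-rowWord bs u≤L bs≤L) ⟩
        n * C + (length bs * C + length o)                 ≡⟨ sym (+-assoc (n * C) _ _) ⟩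
        n * C + length bs * C + length o                   ≤⟨ +-monoˡ-≤ (length o) (≤-reflexive (sym (*-distribʳ-+ C n (length bs)))) ⟩
        (n + length bs) * C + length o                     ≤⟨ +-monoˡ-≤ (length o) (*-monoˡ-≤ C
                                                                (≤-trans (≤-reflexive (+-comm n _)) (+-monoʳ-≤ (length bs) (n≤1+n n)))) ⟩
        (length bs + suc n) * C + length o                 ∎
        where
        open ≤-Reasoning
        C = ⟦ cellCost ⟧ b L
        n = length (encodeRows bss)

      tableWord-fits : ∀ bss → length (encodeRows bss) ≤ L → length (tableWord 0 bss []) ≤ Q
      tableWord-fits bss fits = begin
        length (tableWord 0 bss [])                            ≤⟨ length-tableWord bss fits ⟩
        length (encodeRows bss) * ⟦ cellCost ⟧ b L + 0         ≡⟨ +-identityʳ _ ⟩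
        length (encodeRows bss) * ⟦ cellCost ⟧ b L             ≤⟨ *-monoˡ-≤ _ fits ⟩
        Q                                                      ∎
        where open ≤-Reasoning

      -- `LengthBound` accepts any upper bound on the length of a query, so the bound on the first
      -- answer serves as the size of the second query.
      length-answer : ∀ {w} → length w ≤ Q → length (O (O w)) ≤ A
      length-answer {w} w≤Q = bounded (O w) (bounded w w≤Q)

      consult-oracle : ∀ {w} → length w ≤ Q →
        consult , x ∷ w ∷ r ∷ c ∷ t ∷ s ∷ [] ⇓ x ∷ O (O w) ∷ r ∷ c ∷ t ∷ s ∷ []
          within ⟦ consultCost ⟧ b L
      consult-oracle {w = w} w≤Q =
        relax (s≤s (bounded w w≤Q)) (exactly query) ⨾ relax (s≤s (length-answer {w} w≤Q)) (exactly query)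

      translate-comma : ∀ {x w u τ T} → length w ≤ Q → u ≤ L →
        translate , x ∷ [] ∷ [] ∷ [] ∷ [] ∷ reverse (O (O w)) ∷ [] ⇓ τ within T →
        translate , (comma ∷ x) ∷ w ∷ tally u ∷ [] ∷ [] ∷ [] ∷ [] ⇓ τ within ⟦ commaCost ⟧ b L + T
      translate-comma {w = w} {u} w≤Q u≤L k =
        iterate-translate
          (exactly pop ⨾ consult-oracle w≤Q ⨾
           relax (s≤s (*-monoˡ-≤ 4 (length-answer {w} w≤Q))) (exactly (unload-output-saved (O (O w)))) ⨾
           relax (s≤s (*-monoˡ-≤ 2 (≤-trans (≤-reflexive (length-tally u)) u≤L))) (exactly (erase-row (tally u))))
          k

    -- `unload` reverses a stack, so it is the reversed answers that get compared; injectivity of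
    -- `reverse` undoes this.
    program-correct : ∀ {b} → LengthBound O b → ∀ bss css →
      let input = encodeRows bss ++ comma ∷ encodeRows css in
      ∃[ σ ] ∃[ t ] ∃[ yes? ]
        (O ⊢ program , (input ∷ Vec.replicate 5 []) ⇓ σ ⟨ t ⟩) ×
        t ≤ ⟦ totalCost ⟧ b (length input) ×
        Vec.lookup σ 0F ≡ [ bit yes? ] ×
        Reflects (O (O (tableWord 0 bss [])) ≡ O (O (tableWord 0 css []))) yes?
    program-correct {b} bounded bss css =
      let z , compared , equal? = compare-words (reverse (O (O v))) (reverse (O (O w)))
          t , run , t≤ =
            translated ⨾ consult-oracle bounded L w≤Q ⨾
            relax (s≤s (*-monoˡ-≤ 4 (length-answer bounded L {w} w≤Q)))
              (exactly (unload-output-spare (O (O w)))) ⨾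
            relax (+-monoʳ-≤ 4 (*-monoˡ-≤ 5 reverse≤A)) compared ⨾
            exactly (branch (accept-run z))
      in _ , t , null z , run , t≤ , refl , unreverse equal?
      where
      L = length (encodeRows bss ++ comma ∷ encodeRows css)
      v = tableWord 0 bss []
      w = tableWord 0 css []
      fits : length (encodeRows bss) + suc (length (encodeRows css)) ≤ L
      fits = ≤-reflexive (sym (length-++ (encodeRows bss)))
      bss≤L : length (encodeRows bss) ≤ L
      bss≤L = m+n≤o⇒m≤o _ fits
      css≤L : length (encodeRows css) ≤ L
      css≤L = ≤-trans (n≤1+n _) (m+n≤o⇒n≤o (length (encodeRows bss)) fits)
      v≤Q = tableWord-fits bounded L bss bss≤L
      w≤Q = tableWord-fits bounded L css css≤L

      reverse≤A : length (reverse (O (O v))) ≤ ⟦ answerSize ⟧ b L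
      reverse≤A = ≤-trans (≤-reflexive (length-reverse (O (O v)))) (length-answer bounded L {v} v≤Q)

      final : Store 6
      final = [] ∷ w ∷ tally (length css) ∷ [] ∷ [] ∷ reverse (O (O v)) ∷ []

      translated :
        translate , (encodeRows bss ++ comma ∷ encodeRows css) ∷ Vec.replicate 5 [] ⇓
          final
          within ⟦ (size ⊗ stepCost) ⊕ (commaCost ⊕ ((size ⊗ stepCost) ⊕ const 1)) ⟧ b L
      translated =
        relax (+-mono-≤ (*-monoˡ-≤ _ bss≤L) (+-monoʳ-≤ (⟦ commaCost ⟧ b L) (+-monoˡ-≤ 1 (*-monoˡ-≤ _ css≤L))))
          (translate-table bounded L bss bss≤L λ rows≤L →
           translate-comma bounded L v≤Q rows≤L
             -- `translate-table` leaves a remainder after the rows; after the second matrix this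
             -- remainder is empty.
             (subst (λ x → translate , x ∷ [] ∷ [] ∷ [] ∷ [] ∷ reverse (O (O v)) ∷ [] ⇓ final
                     within length (encodeRows css) * ⟦ stepCost ⟧ b L + 1)
               (++-identityʳ (encodeRows css))
               (translate-table bounded L css css≤L λ _ → exactly (while-end refl))))

      accept-run : ∀ z → accept (top z) , [] ∷ o ∷ r ∷ c ∷ z ∷ s ∷ [] ⇓ [ bit (null z) ] ∷ o ∷ r ∷ c ∷ z ∷ s ∷ [] ⟨ 1 ⟩
      accept-run []      = push
      accept-run (_ ∷ _) = push

      unreverse : ∀ {y} → Reflects (reverse (O (O v)) ≡ reverse (O (O w))) y →
                       Reflects (O (O v) ≡ O (O w)) y
      unreverse (ofʸ eq) = ofʸ (reverse-injective eq)
      unreverse (ofⁿ ne) = ofⁿ (ne ∘ cong reverse)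

-- Numbering by first occurrence

InjectiveOn : ∀ {A B : Set} → Pred A 0ℓ → (A → B) → Set
InjectiveOn Q f = ∀ {x y} → Q x → Q y → f x ≡ f y → x ≡ y

module FirstOccurrence {A : Set} (_≟_ : DecidableEquality A) where

  before : A → List A → List A
  before x = takeWhile (λ y → ¬? (y ≟ x))

  -- This is `number` over an arbitrary type; at `_≟ᶠ_` the two agree by definition.
  index : List A → A → ℕ
  index xs x = length (deduplicate _≟_ (before x xs))

module _ {A : Set} (_≟_ : DecidableEquality A) where
  open FirstOccurrence _≟_

  filter-∩ : ∀ {P Q : Pred A 0ℓ} (P? : Decidable P) (Q? : Decidable Q) xs →
             filter P? (filter Q? xs) ≡ filter (λ x → P? x ×-dec Q? x) xs
  filter-∩ P? Q? [] = refl
  filter-∩ P? Q? (x ∷ xs) with Q? x | P? x in eq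
  ... | no  _ | no  _ = filter-∩ P? Q? xs
  ... | no  _ | yes _ = filter-∩ P? Q? xs
  ... | yes _ | no  _ rewrite eq = filter-∩ P? Q? xs
  ... | yes _ | yes _ rewrite eq = cong (x ∷_) (filter-∩ P? Q? xs)

  -- The predicate is there for the induction, which excludes the head of the
  -- list from the count of the tail.
  filtered-index-injective : ∀ {P : Pred A 0ℓ} (P? : Decidable P) {x y} xs →
    x ∈ˡ xs → y ∈ˡ xs → P x → P y →
    length (filter P? (deduplicate _≟_ (before x xs))) ≡
    length (filter P? (deduplicate _≟_ (before y xs))) → x ≡ y
  filtered-index-injective P? {x} {y} (z ∷ xs) x∈ y∈ Px Py eq with z ≟ x | z ≟ y
  ... | yes refl | yes refl = refl
  ... | yes refl | no  _ with P? z
  ...   | yes _  = ⊥-elim (0≢1+n eq)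
  ...   | no ¬Pz = ⊥-elim (¬Pz Px)
  filtered-index-injective P? {x} {y} (z ∷ xs) x∈ y∈ Px Py eq | no _ | yes refl with P? z
  ...   | yes _  = ⊥-elim (1+n≢0 eq)
  ...   | no ¬Pz = ⊥-elim (¬Pz Py)
  filtered-index-injective P? {x} {y} (z ∷ xs) x∈ y∈ Px Py eq | no z≢x | no z≢y =
    filtered-index-injective (λ w → P? w ×-dec ¬? (z ≟ w)) xs
      (tail z≢x x∈) (tail z≢y y∈) (Px , z≢x) (Py , z≢y)
      (counts (deduplicate _≟_ (before x xs)) (deduplicate _≟_ (before y xs)) eq)
    where
    tail : ∀ {w} → z ≢ w → w ∈ˡ z ∷ xs → w ∈ˡ xs
    tail z≢w (here refl) = ⊥-elim (z≢w refl)
    tail z≢w (there w∈)  = w∈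

    -- `deduplicate` keeps `z` and filters out its later copies. The kept `z` contributes equally to
    -- both counts, and `filter-∩` merges the filtering into the predicate.
    counts : ∀ us vs →
      length (filter P? (z ∷ filter (λ w → ¬? (z ≟ w)) us)) ≡
      length (filter P? (z ∷ filter (λ w → ¬? (z ≟ w)) vs)) →
      length (filter (λ w → P? w ×-dec ¬? (z ≟ w)) us) ≡
      length (filter (λ w → P? w ×-dec ¬? (z ≟ w)) vs)
    counts us vs eq
      rewrite sym (filter-∩ P? (λ w → ¬? (z ≟ w)) us) | sym (filter-∩ P? (λ w → ¬? (z ≟ w)) vs)
      with P? z
    ... | yes _ = suc-injective eq
    ... | no  _ = eq

  index-injective : ∀ xs {x y} → x ∈ˡ xs → y ∈ˡ xs → index xs x ≡ index xs y → x ≡ y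
  index-injective xs {x} {y} x∈ y∈ eq =
    filtered-index-injective (λ _ → yes tt) xs x∈ y∈ tt tt
      (trans (cong length (filter-⊤ (before x xs))) (trans eq (sym (cong length (filter-⊤ (before y xs))))))
    where
    filter-⊤ : ∀ ys → filter (λ _ → yes tt) (deduplicate _≟_ ys) ≡ deduplicate _≟_ ys
    filter-⊤ ys = filter-all (λ _ → yes tt) (All.universal (λ _ → tt) (deduplicate _≟_ ys))

  module _ {Q : Pred A 0ℓ} {f : A → A} (f-inj : InjectiveOn Q f) where

    does-≟ : ∀ {x y} → Q x → Q y → does (f x ≟ f y) ≡ does (x ≟ y)
    does-≟ {x} {y} Qx Qy with x ≟ y
    ... | yes x≡y = dec-true (f x ≟ f y) (cong f x≡y)
    ... | no  x≢y = dec-false (f x ≟ f y) (x≢y ∘ f-inj Qx Qy)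

    before-map : ∀ {x xs} → Q x → All Q xs → before (f x) (map f xs) ≡ map f (before x xs)
    before-map Qx [] = refl
    before-map {x} {y ∷ xs} Qx (Qy ∷ Qxs) rewrite does-≟ Qy Qx with does (y ≟ x)
    ... | true  = refl
    ... | false = cong (f y ∷_) (before-map Qx Qxs)

    filter-map : ∀ {x xs} → Q x → All Q xs →
      filter (λ y → ¬? (f x ≟ y)) (map f xs) ≡ map f (filter (λ y → ¬? (x ≟ y)) xs)
    filter-map Qx [] = refl
    filter-map {x} {y ∷ xs} Qx (Qy ∷ Qxs) rewrite does-≟ Qx Qy with does (x ≟ y)
    ... | true  = filter-map Qx Qxs
    ... | false = cong (f y ∷_) (filter-map Qx Qxs)

    deduplicate-map : ∀ {xs} → All Q xs →
      deduplicate _≟_ (map f xs) ≡ map f (deduplicate _≟_ xs)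
    deduplicate-map [] = refl
    deduplicate-map {x ∷ xs} (Qx ∷ Qxs) rewrite deduplicate-map Qxs =
      cong (f x ∷_) (filter-map Qx (All.deduplicate⁺ _≟_ Qxs))

    -- A map injective on `Q` preserves and reflects equality there, hence commutes with cutting at
    -- a first occurrence and with deduplication.
    index-map : ∀ {x xs} → Q x → All Q xs → index (map f xs) (f x) ≡ index xs x
    index-map {x} {xs} Qx Qxs
      rewrite before-map Qx Qxs
            | deduplicate-map (All.takeWhile⁺ (λ y → ¬? (y ≟ x)) Qxs) =
      length-map f (deduplicate _≟_ (before x xs))

-- Renaming of terms and invariance of patterns

module Formulas (𝒮 : Signature) where
  open Signature 𝒮
  open Logic 𝒮

  symbols : ∀ {s} → Term s → List FreeSymbol
  symbols t = mapMaybe freeSymbol (prefix t)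

  allSymbols : ∀ {as} → All Term as → List FreeSymbol
  allSymbols ts = mapMaybe freeSymbol (prefixes ts)

  relabel : (FreeSymbol → Name) → FreeSymbol → FreeSymbol
  relabel ρ (r , x) = r , ρ (r , x)

  mutual
    symbols-rename : ∀ ρ {s} (t : Term s) → symbols (rename ρ t) ≡ map (relabel ρ) (symbols t)
    symbols-rename ρ (app (theory f) ts) = symbols-renames ρ ts
    symbols-rename ρ (app (free x) ts)   = cong (_ ∷_) (symbols-renames ρ ts)

    symbols-renames : ∀ ρ {as} (ts : All Term as) →
                      allSymbols (renames ρ ts) ≡ map (relabel ρ) (allSymbols ts)
    symbols-renames ρ [] = refl
    symbols-renames ρ (t ∷ ts)
      rewrite mapMaybe-++ freeSymbol (prefix (rename ρ t)) (prefixes (renames ρ ts))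
            | mapMaybe-++ freeSymbol (prefix t) (prefixes ts)
            | map-++ (relabel ρ) (symbols t) (allSymbols ts) =
      cong₂ _++_ (symbols-rename ρ t) (symbols-renames ρ ts)

  mutual
    rename-∘ : ∀ τ ρ {s} (t : Term s) → rename τ (rename ρ t) ≡ rename (τ ∘ relabel ρ) t
    rename-∘ τ ρ (app (theory f) ts) = cong (app (theory f)) (renames-∘ τ ρ ts)
    rename-∘ τ ρ (app (free x) ts)   = cong (app (free _)) (renames-∘ τ ρ ts)

    renames-∘ : ∀ τ ρ {as} (ts : All Term as) →
                renames τ (renames ρ ts) ≡ renames (τ ∘ relabel ρ) ts
    renames-∘ τ ρ []       = refl
    renames-∘ τ ρ (t ∷ ts) = cong₂ _∷_ (rename-∘ τ ρ t) (renames-∘ τ ρ ts)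

  mutual
    rename-cong : ∀ {ρ σ s} (t : Term s) → All (λ f → ρ f ≡ σ f) (symbols t) →
                  rename ρ t ≡ rename σ t
    rename-cong (app (theory f) ts) eqs        = cong (app (theory f)) (renames-cong ts eqs)
    rename-cong (app (free x) ts)   (eq ∷ eqs) = cong₂ (λ y → app (free y)) eq (renames-cong ts eqs)

    renames-cong : ∀ {ρ σ as} (ts : All Term as) → All (λ f → ρ f ≡ σ f) (allSymbols ts) →
                   renames ρ ts ≡ renames σ ts
    renames-cong [] eqs = refl
    renames-cong (t ∷ ts) eqs
      rewrite mapMaybe-++ freeSymbol (prefix t) (prefixes ts) =
      cong₂ _∷_ (rename-cong t (All.++⁻ˡ _ eqs)) (renames-cong ts (All.++⁻ʳ (symbols t) eqs))

  occurrences-∷ : ∀ α A → occurrences (α ∷ A) ≡ symbols α ++ occurrences A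
  occurrences-∷ α A = mapMaybe-++ freeSymbol (prefix α) (concatMap prefix A)

  occurrences-rename : ∀ ρ A → occurrences (map (rename ρ) A) ≡ map (relabel ρ) (occurrences A)
  occurrences-rename ρ [] = refl
  occurrences-rename ρ (α ∷ A)
    rewrite occurrences-∷ (rename ρ α) (map (rename ρ) A)
          | occurrences-∷ α A
          | map-++ (relabel ρ) (symbols α) (occurrences A) =
    cong₂ _++_ (symbols-rename ρ α) (occurrences-rename ρ A)

  ∈-occurrences : ∀ {f α A} → f ∈ˡ symbols α → α ∈ˡ A → f ∈ˡ occurrences A
  ∈-occurrences {A = α ∷ A} f∈ (here refl) rewrite occurrences-∷ α A = ∈-++⁺ˡ f∈
  ∈-occurrences {A = α ∷ A} f∈ (there α∈)  rewrite occurrences-∷ α A =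
    ∈-++⁺ʳ (symbols α) (∈-occurrences f∈ α∈)

  all-occurrences : ∀ {Q : Pred FreeSymbol 0ℓ} {A} → All (All Q ∘ symbols) A → All Q (occurrences A)
  all-occurrences [] = []
  all-occurrences {A = α ∷ A} (p ∷ ps) rewrite occurrences-∷ α A = All.++⁺ p (all-occurrences ps)

  -- A pattern depends only on the order of first occurrences, which a renaming injective on the
  -- occurring symbols does not change.
  P-rename : ∀ {Q : Pred FreeSymbol 0ℓ} {ρ A} → InjectiveOn Q (relabel ρ) → All (All Q ∘ symbols) A →
             P (map (rename ρ) A) ≡ P A
  P-rename {Q} {ρ} {A} inj QA = begin
    map (rename ν′) (map (rename ρ) A)    ≡⟨ sym (map-∘ A) ⟩
    map (rename ν′ ∘ rename ρ) A          ≡⟨ map-cong (rename-∘ ν′ ρ) A ⟩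
    map (rename (ν′ ∘ relabel ρ)) A       ≡⟨ map-cong-local (All.map (rename-cong _ ∘ All.map same) QA) ⟩
    P A                                   ∎
    where
    open ≡-Reasoning
    ν′ : FreeSymbol → Name
    ν′ f = pat (number (occurrences (map (rename ρ) A)) f)

    same : ∀ {f} → Q f → ν′ (relabel ρ f) ≡ pat (number (occurrences A) f)
    same Qf rewrite occurrences-rename ρ A =
      cong pat (index-map _≟ᶠ_ inj Qf (all-occurrences QA))

  mutual
    ∈ᶜ-refl : ∀ {s} (t : Term s) → t ∈ᶜ t
    ∈ᶜ-refl (app σ ts) = keep (∈ᶜ*-refl ts)

    ∈ᶜ*-refl : ∀ {as} (ts : All Term as) → ts ∈ᶜ* ts
    ∈ᶜ*-refl []       = []
    ∈ᶜ*-refl (t ∷ ts) = ∈ᶜ-refl t ∷ ∈ᶜ*-refl ts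

  C-refl : ∀ {X A} → A ∈ X → A ∈ C X
  C-refl {A = A} A∈X = A , A∈X , pointwise A
    where
    pointwise : ∀ A → Pointwise _∈ᶜ_ A A
    pointwise []      = []
    pointwise (α ∷ A) = ∈ᶜ-refl α ∷ pointwise A

  -- Formulas describing a graph

  vertexRank edgeRank : Rank
  vertexRank = [] , bool
  edgeRank   = (bool ∷ bool ∷ []) , bool

  vertex : Name → Formula
  vertex x = app (free x) []

  -- The two shapes differ in arity, so adjacency can be read off. The diagonal always takes the
  -- second shape, hence every vertex has its name as a formula of its own.
  cell : Bool → Name → Name → Name → Formula
  cell true  e x y = app (free e) (vertex x ∷ vertex y ∷ [])
  cell false e x y = vertex x

  pairs : ∀ n → List (Fin n × Fin n)
  pairs n = cartesianProduct (allFin n) (allFin n)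

  graphFormulas : ∀ G → Name → (Fin (order G) → Name) → List Formula
  graphFormulas G e x = map (λ (u , v) → cell (adjacent G u v) e (x u) (x v)) (pairs (order G))

  -- E and the x_u have different ranks and cannot clash even under equal names, so distinctness is
  -- a condition on the x_u alone.
  Describes : Graph → List Formula → Set
  Describes G X = ∃[ e ] ∃[ x ] (∀ {u v} → x u ≡ x v → u ≡ v) × X ↭ graphFormulas G e x

  data GraphSymbol {n} (e : Name) (x : Fin n → Name) : Pred FreeSymbol 0ℓ where
    edge : GraphSymbol e x (edgeRank , e)
    node : ∀ u → GraphSymbol e x (vertexRank , x u)

  symbols-graphFormulas : ∀ G {e x} → All (All (GraphSymbol e x) ∘ symbols) (graphFormulas G e x)
  symbols-graphFormulas G {e} {x} = All.map⁺ (All.universal (λ (u , v) → symbols-cell (adjacent G u v)) _)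
    where
    symbols-cell : ∀ b {u v} → All (GraphSymbol e x) (symbols (cell b e (x u) (x v)))
    symbols-cell true  = edge ∷ node _ ∷ node _ ∷ []
    symbols-cell false = node _ ∷ []

  rename-graphFormulas : ∀ ρ G e x → map (rename ρ) (graphFormulas G e x) ≡
    graphFormulas G (ρ (edgeRank , e)) (λ u → ρ (vertexRank , x u))
  rename-graphFormulas ρ G e x =
    trans (sym (map-∘ _)) (map-cong (λ (u , v) → rename-cell (adjacent G u v)) (pairs (order G)))
    where
    rename-cell : ∀ b {y z} → rename ρ (cell b e y z) ≡
      cell b (ρ (edgeRank , e)) (ρ (vertexRank , y)) (ρ (vertexRank , z))
    rename-cell true  = refl
    rename-cell false = refl

  -- Swapping requires a theory symbol at the head, and graph formulas have none. Each is thus its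
  -- own only reordering, and `C` adds nothing to the permutations of `X`.
  pattern-of : ∀ {G X M} → Describes G X → M ∈ P[ C (S X) ] → ∃[ X′ ] X′ ↭ X × M ≡ P X′
  pattern-of {G} (e , x , _ , X↭) (X′ , (X″ , X″↭X , X′∈X″) , M≡) =
    X′ , subst (_↭ _) (sym (fixed (All-resp-↭ (↭-sym (↭-trans X″↭X X↭)) rigid) X′∈X″)) X″↭X , M≡
    where
    Rigid : Formula → Set
    Rigid α = ∀ {β} → β ∈ᶜ α → β ≡ α

    rigid-cell : ∀ b {y z} → Rigid (cell b e y z)
    rigid-cell true  (keep (keep [] ∷ keep [] ∷ [])) = refl
    rigid-cell false (keep [])                       = refl

    rigid : All Rigid (graphFormulas G e x)
    rigid = All.map⁺ (All.universal (λ (u , v) → rigid-cell (adjacent G u v)) _)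

    fixed : ∀ {A A′} → All Rigid A → Pointwise _∈ᶜ_ A′ A → A′ ≡ A
    fixed [] [] = refl
    fixed (p ∷ ps) (q ∷ qs) = cong₂ _∷_ (p q) (fixed ps qs)

  vertex∈ : ∀ G {e x} u → vertex (x u) ∈ˡ graphFormulas G e x
  vertex∈ G {e} {x} u =
    subst (_∈ˡ graphFormulas G e x) (cong (λ b → cell b e (x u) (x u)) (loopless G u))
      (∈-map⁺ _ (∈-cartesianProduct⁺ (∈-allFin u) (∈-allFin u)))

  edge∈ : ∀ G {e x} u v → adjacent G u v ≡ true → cell true e (x u) (x v) ∈ˡ graphFormulas G e x
  edge∈ G {e} {x} u v uv =
    subst (_∈ˡ graphFormulas G e x) (cong (λ b → cell b e (x u) (x v)) uv)
      (∈-map⁺ _ (∈-cartesianProduct⁺ (∈-allFin u) (∈-allFin v)))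

  vertex∈⁻ : ∀ G {e x y} → vertex y ∈ˡ graphFormulas G e x → ∃[ u ] y ≡ x u
  vertex∈⁻ G y∈ with ∈-map⁻ _ y∈
  ... | (u , v) , _ , eq = u , split (adjacent G u v) eq
    where
    split : ∀ b {e y x z} → vertex y ≡ cell b e x z → y ≡ x
    split false refl = refl

  edge∈⁻ : ∀ G {e e′ x y z} → cell true e′ y z ∈ˡ graphFormulas G e x →
           ∃[ u ] ∃[ v ] adjacent G u v ≡ true × y ≡ x u × z ≡ x v
  edge∈⁻ G yz∈ with ∈-map⁻ _ yz∈
  ... | (u , v) , _ , eq = u , v , split (adjacent G u v) eq
    where
    split : ∀ b {e e′ y z x w} → cell true e′ y z ≡ cell b e x w → b ≡ true × y ≡ x × z ≡ w
    split true refl = refl , refl , refl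

  -- N(X) is R(P(X′)) for a permutation X′ of `X`. Numbering the symbols and then applying R is one
  -- renaming, `ρ`, under which the x_u stay distinct.
  describes-normal : ∀ {V N} → Normalizing V N → ∀ {G X} → Describes G X → Describes G (N X)
  describes-normal {N = N} normalizing {G} {X} D@(e , x , x-inj , X↭) with Normalizing.renamed normalizing X
  ... | M , M∈ , R , NX≡ with pattern-of {G} D M∈
  ... | X′ , X′↭X , refl =
    ρ (edgeRank , e) , (λ u → ρ (vertexRank , x u)) ,
    (λ eq → x-inj (,-injectiveʳ (index-injective _≟ᶠ_ (occurrences X′) (occurs _) (occurs _) (injective _ eq)))) ,
    ↭-trans (↭-reflexive (trans NX≡ NX≡ρX′))
      (↭-trans (↭-map⁺ _ X′↭) (↭-reflexive (rename-graphFormulas ρ G e x)))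
    where
    open Renaming R
    ρ : FreeSymbol → Name
    ρ f = image (proj₁ f) (number (occurrences X′) f)

    X′↭ : X′ ↭ graphFormulas G e x
    X′↭ = ↭-trans X′↭X X↭

    NX≡ρX′ : R · P X′ ≡ map (rename ρ) X′
    NX≡ρX′ = trans (sym (map-∘ X′)) (map-cong (rename-∘ onSymbol _) X′)

    occurs : ∀ u → (vertexRank , x u) ∈ˡ occurrences X′
    occurs u = ∈-occurrences (here refl) (∈-resp-↭ (↭-sym X′↭) (vertex∈ G u))

  -- Replacing the names used by `X` with those used by `Y` turns a permutation of `X` into one of
  -- `Y`, and leaves its pattern unchanged by `P-rename`.
  describes⇒patterns : ∀ {G X Y M} → Describes G X → Describes G Y → M ∈ P[ C (S X) ] → M ∈ P[ C (S Y) ]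
  describes⇒patterns {G} {Y = Y} D@(e , x , x-inj , X↭) (e′ , x′ , x′-inj , Y↭) M∈ with pattern-of {G} D M∈
  ... | X′ , X′↭X , refl =
    map (rename ρ) X′ , C-refl {S Y} ρX′↭Y ,
    sym (P-rename ρ-inj (All-resp-↭ (↭-sym X′↭) (symbols-graphFormulas G)))
    where
    X′↭ : X′ ↭ graphFormulas G e x
    X′↭ = ↭-trans X′↭X X↭

    preimage : ∀ y → Dec (∃[ u ] x u ≡ y)
    preimage y = any? λ u → x u ≟ᴺ y

    ρ : FreeSymbol → Name
    ρ (([] , _) , y) with preimage y
    ... | yes (u , _) = x′ u
    -- A default for names outside the image of `x`; none of the nullary symbols of X′ has one.
    ... | no  _       = y
    -- E is the only symbol with arguments in these formulas.
    ρ ((_ ∷ _ , _) , _) = e′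

    ρ-vertex : ∀ u → ρ (vertexRank , x u) ≡ x′ u
    ρ-vertex u with preimage (x u)
    ... | yes (v , xv≡xu) = cong x′ (x-inj xv≡xu)
    ... | no  ∄           = ⊥-elim (∄ (u , refl))

    ρ-inj : InjectiveOn (GraphSymbol e x) (relabel ρ)
    ρ-inj edge     edge     eq = refl
    ρ-inj (node u) (node v) eq =
      cong (λ w → vertexRank , x w)
        (x′-inj (trans (sym (ρ-vertex u)) (trans (,-injectiveʳ eq) (ρ-vertex v))))
    -- `relabel` keeps ranks, and only E takes arguments.
    ρ-inj edge     (node v) eq with () ← cong (λ f → proj₁ (proj₁ f)) eq
    ρ-inj (node u) edge     eq with () ← cong (λ f → proj₁ (proj₁ f)) eq

    ρX′↭Y : map (rename ρ) X′ ↭ Y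
    ρX′↭Y = ↭-trans (↭-map⁺ _ X′↭) (↭-trans (↭-reflexive (trans (rename-graphFormulas ρ G e x) same)) (↭-sym Y↭))
      where
      same : graphFormulas G e′ (λ u → ρ (vertexRank , x u)) ≡ graphFormulas G e′ x′
      same = map-cong (λ (u , v) → cong₂ (cell (adjacent G u v) e′) (ρ-vertex u) (ρ-vertex v)) (pairs (order G))

  -- Vertices correspond by having the same name, found through the nullary formulas; the binary
  -- formulas, being common to both lists, carry adjacency in both directions.
  describes-unique : ∀ {G H X} → Describes G X → Describes H X → G ≅ H
  describes-unique {G} {H} (e , x , x-inj , X↭G) (e′ , y , y-inj , X↭H) =
    mk↔ₛ′ to from to-from from-to , λ u v → ≡-true (edge-to u v) (edge-from u v)
    where
    G↭H : graphFormulas G e x ↭ graphFormulas H e′ y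
    G↭H = ↭-trans (↭-sym X↭G) X↭H

    partner : ∀ u → ∃[ w ] x u ≡ y w
    partner u = vertex∈⁻ H (∈-resp-↭ G↭H (vertex∈ G u))

    partner⁻¹ : ∀ w → ∃[ u ] y w ≡ x u
    partner⁻¹ w = vertex∈⁻ G (∈-resp-↭ (↭-sym G↭H) (vertex∈ H w))

    to : Fin (order G) → Fin (order H)
    to u = proj₁ (partner u)

    from : Fin (order H) → Fin (order G)
    from w = proj₁ (partner⁻¹ w)

    to-from : ∀ w → to (from w) ≡ w
    to-from w = y-inj (sym (trans (proj₂ (partner⁻¹ w)) (proj₂ (partner (from w)))))

    from-to : ∀ u → from (to u) ≡ u
    from-to u = x-inj (sym (trans (proj₂ (partner u)) (proj₂ (partner⁻¹ (to u)))))

    edge-to : ∀ u v → adjacent G u v ≡ true → adjacent H (to u) (to v) ≡ true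
    edge-to u v uv with edge∈⁻ H (∈-resp-↭ G↭H (edge∈ G u v uv))
    ... | w , z , wz , xu≡yw , xv≡yz =
      subst₂ (λ w z → adjacent H w z ≡ true)
        (y-inj (trans (sym xu≡yw) (proj₂ (partner u))))
        (y-inj (trans (sym xv≡yz) (proj₂ (partner v)))) wz

    edge-from : ∀ u v → adjacent H (to u) (to v) ≡ true → adjacent G u v ≡ true
    edge-from u v uv with edge∈⁻ G (∈-resp-↭ (↭-sym G↭H) (edge∈ H (to u) (to v) uv))
    ... | w , z , wz , yu≡xw , yv≡xz =
      subst₂ (λ w z → adjacent G w z ≡ true)
        (x-inj (sym (trans (proj₂ (partner u)) yu≡xw)))
        (x-inj (sym (trans (proj₂ (partner v)) yv≡xz))) wz

    ≡-true : ∀ {a b} → (a ≡ true → b ≡ true) → (b ≡ true → a ≡ true) → a ≡ b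
    ≡-true {true}  {_}     f g = sym (f refl)
    ≡-true {false} {true}  f g = g refl
    ≡-true {false} {false} f g = refl

  -- Both lists are free of duplicates and contain every pair, so they are permutations of each
  -- other.
  pairs-↔ : ∀ {m n} (π : Fin m ↔ Fin n) →
            map (λ (u , v) → Inverse.to π u , Inverse.to π v) (pairs m) ↭ pairs n
  pairs-↔ {m} {n} π = ∼bag⇒↭ (unique∧set⇒bag
    (Unique.map⁺ (λ eq → cong₂ _,_ (injective (,-injectiveˡ eq)) (injective (,-injectiveʳ eq))) (unique m))
    (unique n)
    (mk⇔ (λ _ → complete _) (λ _ → covered _)))
    where
    open Inverse π

    injective : ∀ {u v} → to u ≡ to v → u ≡ v
    injective eq = trans (sym (strictlyInverseʳ _)) (trans (cong from eq) (strictlyInverseʳ _))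

    unique : ∀ k → Unique (pairs k)
    unique k = Unique.cartesianProduct⁺ (Unique.allFin⁺ k) (Unique.allFin⁺ k)

    complete : ∀ {k} (p : Fin k × Fin k) → p ∈ˡ pairs k
    complete (u , v) = ∈-cartesianProduct⁺ (∈-allFin u) (∈-allFin v)

    covered : ∀ q → q ∈ˡ map (λ (u , v) → to u , to v) (pairs m)
    covered (w , z) = subst (_∈ˡ map _ (pairs m)) (cong₂ _,_ (strictlyInverseˡ w) (strictlyInverseˡ z))
                            (∈-map⁺ (λ (u , v) → to u , to v) (complete (from w , from z)))

  -- The names are pulled back along the inverse of `π`; only the order in which the pairs are
  -- listed changes.
  describes-≅ : ∀ {G H X} → G ≅ H → Describes G X → Describes H X
  describes-≅ {G} {H} (π , preserves) (e , x , x-inj , X↭) =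
    e , x ∘ from ,
    (λ eq → trans (sym (strictlyInverseˡ _)) (trans (cong to (x-inj eq)) (strictlyInverseˡ _))) ,
    ↭-trans X↭ (↭-trans (↭-reflexive relabelled) (↭-map⁺ _ (pairs-↔ π)))
    where
    open Inverse π
    relabelled : graphFormulas G e x ≡
      map (λ (w , z) → cell (adjacent H w z) e (x (from w)) (x (from z)))
          (map (λ (u , v) → to u , to v) (pairs (order G)))
    relabelled = trans
      (map-cong (λ (u , v) → cell-cong (preserves u v) (strictlyInverseʳ u) (strictlyInverseʳ v)) (pairs (order G)))
      (map-∘ (pairs (order G)))
      where
      cell-cong : ∀ {a b u v u′ v′} → a ≡ b → u′ ≡ u → v′ ≡ v →
                  cell a e (x u) (x v) ≡ cell b e (x u′) (x v′)
      cell-cong refl refl refl = refl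

  ≅-sym : ∀ {G H} → G ≅ H → H ≅ G
  ≅-sym {G} {H} (π , preserves) = ↔-sym π , λ w z →
    trans (sym (cong₂ (adjacent H) (strictlyInverseˡ w) (strictlyInverseˡ z))) (sym (preserves (from w) (from z)))
    where open Inverse π

  -- Isomorphism through normalizing twice

  module _ {V N} (normalizing : Normalizing V N) where

    normal-twice⇒≅ : ∀ {G H X Y} → Describes G X → Describes H Y → N (N X) ≡ N (N Y) → G ≅ H
    normal-twice⇒≅ {G} {H} G∼X H∼Y eq =
      describes-unique {G} {H} (twice {G} G∼X) (subst (Describes H) (sym eq) (twice {H} H∼Y))
      where
      twice : ∀ {G X} → Describes G X → Describes G (N (N X))
      twice {G} = describes-normal normalizing {G} ∘ describes-normal normalizing {G}

    -- The first normalization turns both lists into renamed patterns. Both patterns belong to `X`,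
    -- since `Y` describes `G` as well, so condition (2) at `X` applies.
    ≅⇒normal-twice : ∀ {G H X Y} → Describes G X → Describes H Y → G ≅ H → N (N X) ≡ N (N Y)
    ≅⇒normal-twice {G} {H} {X} {Y} G∼X H∼Y G≅H
      with Normalizing.renamed normalizing X | Normalizing.renamed normalizing Y
    ... | M₁ , M₁∈ , R₁ , NX≡ | M₂ , M₂∈ , R₂ , NY≡ =
      trans (cong N NX≡) (trans
        (Normalizing.unique normalizing X R₁ R₂ M₁∈
          (describes⇒patterns {G} (describes-≅ {H} {G} (≅-sym {G} {H} G≅H) H∼Y) G∼X M₂∈))
        (sym (cong N NY≡)))

  -- Unique readability

  -- The letters that can end a bit string.
  Mark : Letter → Set
  Mark (bit _) = ⊥
  Mark _       = ⊤

  bits-++-injective : ∀ xs ys {a b v w} → Mark a → Mark b →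
    bits xs ++ a ∷ v ≡ bits ys ++ b ∷ w → xs ≡ ys × a ∷ v ≡ b ∷ w
  bits-++-injective []       []       _ _ eq = refl , eq
  bits-++-injective (x ∷ xs) (y ∷ ys) α β eq with ∷-injective eq
  ... | refl , eq′ with bits-++-injective xs ys α β eq′
  ...   | refl , eq″ = refl , eq″
  bits-++-injective []       (y ∷ ys) () β refl
  bits-++-injective (x ∷ xs) []       α () refl

  -- The digits of a number are computed by a local function of `binary`, so
  -- their recursion equations can only be stated through `binary` itself.
  binary-2[1+_] : ∀ m → binary (ℕᵇ-toℕ 2[1+ m ]) ≡ true ∷ binary (ℕᵇ-toℕ m)
  binary-2[1+ m ] rewrite fromℕ-toℕ 2[1+ m ] | fromℕ-toℕ m = refl

  binary-1+[2_] : ∀ m → binary (ℕᵇ-toℕ 1+[2 m ]) ≡ false ∷ binary (ℕᵇ-toℕ m)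
  binary-1+[2 m ] rewrite fromℕ-toℕ 1+[2 m ] | fromℕ-toℕ m = refl

  binary-injective : ∀ {m n} → binary m ≡ binary n → m ≡ n
  binary-injective {m} {n} eq = fromℕ-injective (go (fromℕ m) (fromℕ n)
    (trans (cong binary (toℕ-fromℕ m)) (trans eq (sym (cong binary (toℕ-fromℕ n))))))
    where
    go : ∀ a b → binary (ℕᵇ-toℕ a) ≡ binary (ℕᵇ-toℕ b) → a ≡ b
    go zero zero _ = refl
    go zero 2[1+ b ] eq with () ← trans eq binary-2[1+ b ]
    go zero 1+[2 b ] eq with () ← trans eq binary-1+[2 b ]
    go 2[1+ a ] zero eq with () ← trans (sym eq) binary-2[1+ a ]
    go 1+[2 a ] zero eq with () ← trans (sym eq) binary-1+[2 a ]
    go 2[1+ a ] 2[1+ b ] eq =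
      cong 2[1+_] (go a b (∷-injectiveʳ (trans (sym binary-2[1+ a ]) (trans eq binary-2[1+ b ]))))
    go 1+[2 a ] 1+[2 b ] eq =
      cong 1+[2_] (go a b (∷-injectiveʳ (trans (sym binary-1+[2 a ]) (trans eq binary-1+[2 b ]))))
    go 2[1+ a ] 1+[2 b ] eq with () ← trans (sym binary-2[1+ a ]) (trans eq binary-1+[2 b ])
    go 1+[2 a ] 2[1+ b ] eq with () ← trans (sym binary-1+[2 a ]) (trans eq binary-2[1+ b ])

  code : Sort → Bits
  code = Injection.to sortCode

  code-injective : ∀ {s t} → code s ≡ code t → s ≡ t
  code-injective = Injection.injective sortCode

  -- The letters that can follow a rank. As `comma` is not among them, the letter after a sort tells
  -- whether another sort follows.
  data Tag : Letter → Set where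
    theory : Tag tagTheory
    user   : Tag tagUser
    pat    : Tag tagPat

  tag-mark : ∀ {a} → Tag a → Mark a
  tag-mark theory = _
  tag-mark user   = _
  tag-mark pat    = _

  comma-not-tag : ¬ Tag comma
  comma-not-tag ()

  encodeRank-∷ : ∀ a as s w → encodeRank (a ∷ as , s) ++ w ≡ bits (code a) ++ comma ∷ encodeRank (as , s) ++ w
  encodeRank-∷ a as s w = trans (cong (_++ w) (++-assoc (bits (code a) ++ [ comma ]) _ _)) (trans (++-assoc (bits (code a) ++ [ comma ]) _ w) (++-assoc (bits (code a)) _ _))

  encodeRank-injective : ∀ as {s} bs {t a b v w} → Tag a → Tag b →
    encodeRank (as , s) ++ a ∷ v ≡ encodeRank (bs , t) ++ b ∷ w → (as , s) ≡ (bs , t) × a ∷ v ≡ b ∷ w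
  encodeRank-injective [] [] α β eq with bits-++-injective _ _ (tag-mark α) (tag-mark β) eq
  ... | s≡t , eq′ = cong (_ ,_) (code-injective s≡t) , eq′
  encodeRank-injective [] (b ∷ bs) {t} α β eq
    with bits-++-injective _ (code b) (tag-mark α) _ (trans eq (encodeRank-∷ b bs t _))
  ... | _ , refl = ⊥-elim (comma-not-tag α)
  encodeRank-injective (a ∷ as) {s} [] α β eq
    with bits-++-injective (code a) _ _ (tag-mark β) (trans (sym (encodeRank-∷ a as s _)) eq)
  ... | _ , refl = ⊥-elim (comma-not-tag β)
  encodeRank-injective (a ∷ as) {s} (b ∷ bs) {t} α β eq
    with bits-++-injective (code a) (code b) _ _
           (trans (sym (encodeRank-∷ a as s _)) (trans eq (encodeRank-∷ b bs t _)))
  ... | a≡b , eq′ with encodeRank-injective as bs α β (∷-injectiveʳ eq′)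
  ... | refl , eq″ = cong (λ a → (a ∷ _) , _) (code-injective a≡b) , eq″

  -- `tag` and `label` split the encoding of a symbol's body, which is local to `encodeSymbol` and
  -- reduces only after a case distinction.
  tag : ∀ {r} → Symbol r → Letter
  tag (theory _)      = tagTheory
  tag (free (user _)) = tagUser
  tag (free (pat _))  = tagPat

  tag-Tag : ∀ {r} (σ : Symbol r) → Tag (tag σ)
  tag-Tag (theory _)      = theory
  tag-Tag (free (user _)) = user
  tag-Tag (free (pat _))  = pat

  label : ∀ {r} → Symbol r → Bits
  label (theory f)      = Injection.to theoryCode f
  label (free (user x)) = x
  label (free (pat k))  = binary k

  -- The rank is written before the symbol, so it can be taken as common here; `theoryCode` is
  -- injective rank by rank.
  symbol-injective : ∀ {r} (σ τ : Symbol r) → tag σ ≡ tag τ → label σ ≡ label τ → σ ≡ τ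
  symbol-injective (theory f)      (theory g)      _ eq = cong theory (Injection.injective theoryCode eq)
  symbol-injective (free (user x)) (free (user y)) _ eq = cong (free ∘ user) eq
  symbol-injective (free (pat k))  (free (pat l))  _ eq = cong (free ∘ pat) (binary-injective eq)
  symbol-injective (theory f)      (free (user y)) () _
  symbol-injective (theory f)      (free (pat l))  () _
  symbol-injective (free (user x)) (theory g)      () _
  symbol-injective (free (user x)) (free (pat l))  () _
  symbol-injective (free (pat k))  (theory g)      () _
  symbol-injective (free (pat k))  (free (user y)) () _

  encodeSymbol-tag : ∀ r (σ : Symbol r) w →
    encodeSymbol (r , σ) ++ w ≡ encodeRank r ++ tag σ ∷ bits (label σ) ++ semi ∷ w
  encodeSymbol-tag r σ w = trans (cong (_++ w) (by-cases σ))
    (trans (++-assoc (encodeRank r) _ w)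
           (cong (λ v → encodeRank r ++ tag σ ∷ v) (++-assoc (bits (label σ)) [ semi ] w)))
    where
    by-cases : ∀ (σ : Symbol r) →
      encodeSymbol (r , σ) ≡ encodeRank r ++ tag σ ∷ bits (label σ) ++ [ semi ]
    by-cases (theory _)      = refl
    by-cases (free (user _)) = refl
    by-cases (free (pat _))  = refl

  encodeSymbol-injective : ∀ {r r′} (σ : Symbol r) (τ : Symbol r′) {v w} →
    encodeSymbol (r , σ) ++ v ≡ encodeSymbol (r′ , τ) ++ w → (r , σ) ≡ (r′ , τ) × v ≡ w
  encodeSymbol-injective {r} {r′} σ τ {v} {w} eq
    with encodeRank-injective (proj₁ r) (proj₁ r′) (tag-Tag σ) (tag-Tag τ)
           (trans (sym (encodeSymbol-tag r σ v)) (trans eq (encodeSymbol-tag r′ τ w)))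
  ... | refl , eq′ with bits-++-injective (label σ) (label τ) _ _ (∷-injectiveʳ eq′)
  ... | label≡ , eq″ = cong (r ,_) (symbol-injective σ τ (∷-injectiveˡ eq′) label≡) , ∷-injectiveʳ eq″

  mutual
    -- The rank of the head symbol fixes the number and sorts of the arguments, so a term can be
    -- split off from whatever follows it.
    encodeTerm-injective : ∀ {s} (t t′ : Term s) {v w} →
      concatMap encodeSymbol (prefix t) ++ v ≡ concatMap encodeSymbol (prefix t′) ++ w → t ≡ t′ × v ≡ w
    encodeTerm-injective (app {as} {s} σ ts) (app {as′} σ′ ts′) {v} {w} eq
      with encodeSymbol-injective σ σ′
             (trans (sym (++-assoc (encodeSymbol ((as , s) , σ)) (concatMap encodeSymbol (prefixes ts)) v))
               (trans eq (++-assoc (encodeSymbol ((as′ , s) , σ′)) (concatMap encodeSymbol (prefixes ts′)) w)))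
    ... | refl , eq′ with encodeTerms-injective ts ts′ eq′
    ... | refl , eq″ = refl , eq″

    encodeTerms-injective : ∀ {as} (ts ts′ : All Term as) {v w} →
      concatMap encodeSymbol (prefixes ts) ++ v ≡ concatMap encodeSymbol (prefixes ts′) ++ w → ts ≡ ts′ × v ≡ w
    encodeTerms-injective []       []         eq = refl , eq
    encodeTerms-injective (t ∷ ts) (t′ ∷ ts′) eq
      with encodeTerm-injective t t′ (trans (sym (regroup t ts _)) (trans eq (regroup t′ ts′ _)))
    ... | refl , eq′ with encodeTerms-injective ts ts′ eq′
    ... | refl , eq″ = refl , eq″

    regroup : ∀ {s as} (t : Term s) (ts : All Term as) v →
      concatMap encodeSymbol (prefixes (t ∷ ts)) ++ v ≡
      concatMap encodeSymbol (prefix t) ++ concatMap encodeSymbol (prefixes ts) ++ v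
    regroup t ts v = trans (cong (_++ v) (concatMap-++ encodeSymbol (prefix t) (prefixes ts)))
                           (++-assoc (concatMap encodeSymbol (prefix t)) _ v)

  encodeFormulas-∷ : ∀ α A → encodeFormulas (α ∷ A) ≡ concatMap encodeSymbol (prefix α) ++ semi ∷ encodeFormulas A
  encodeFormulas-∷ α A = ++-assoc (concatMap encodeSymbol (prefix α)) [ semi ] (encodeFormulas A)

  encodeFormulas-injective : ∀ A B → encodeFormulas A ≡ encodeFormulas B → A ≡ B
  encodeFormulas-injective []      []      eq = refl
  encodeFormulas-injective []      (β ∷ B) eq
    -- A nonempty list is encoded by a word containing `semi`.
    with () ← ++-conicalʳ (concatMap encodeSymbol (prefix β)) _ (sym (trans eq (encodeFormulas-∷ β B)))
  encodeFormulas-injective (α ∷ A) []      eq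
    with () ← ++-conicalʳ (concatMap encodeSymbol (prefix α)) _ (trans (sym (encodeFormulas-∷ α A)) eq)
  encodeFormulas-injective (α ∷ A) (β ∷ B) eq
    with encodeTerm-injective α β (trans (sym (encodeFormulas-∷ α A)) (trans eq (encodeFormulas-∷ β B)))
  ... | refl , eq′ = cong (α ∷_) (encodeFormulas-injective A B (∷-injectiveʳ eq′))

-- The reduction from graph isomorphism

module Reduction (𝒮 : Signature) where
  open Signature 𝒮
  open Logic 𝒮
  open Formulas 𝒮

  name : ℕ → Name
  name u = user (replicate u true)

  name-injective : ∀ {u v} → name u ≡ name v → u ≡ v
  name-injective {u} {v} eq =
    trans (sym (length-replicate u)) (trans (cong size-of eq) (length-replicate v))
    where
    size-of : Name → ℕ
    size-of (user x) = length x
    size-of (pat k)  = k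

  -- E and x_0 share the empty name and are told apart by their ranks.
  cellFormula : Bool → ℕ → ℕ → Formula
  cellFormula b u v = cell b (user []) (name u) (name v)

  rowFormulas : ℕ → ℕ → Bits → List Formula → List Formula
  rowFormulas u v []       A = A
  rowFormulas u v (b ∷ bs) A = rowFormulas u (suc v) bs (cellFormula b u v ∷ A)

  tableFormulas : ℕ → List Bits → List Formula → List Formula
  tableFormulas u []         A = A
  tableFormulas u (bs ∷ bss) A = tableFormulas (suc u) bss (rowFormulas u 0 bs A)

  open Machine (encodeRank vertexRank ++ [ tagUser ]) (encodeSymbol (edgeRank , free (user [])))
    using (variableWord; cellWord; rowWord; tableWord; program; totalCost; program-correct)

  encode-vertex : ∀ u → encodeSymbol (vertexRank , free (name u)) ≡ variableWord u
  encode-vertex u = sym (++-assoc (encodeRank vertexRank) [ tagUser ] _)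

  encode-cell : ∀ b u v A → cellWord b u v ++ encodeFormulas A ≡ encodeFormulas (cellFormula b u v ∷ A)
  encode-cell b u v A = cong (_++ encodeFormulas A) (sym (encoded b))
    where
    open ≡-Reasoning
    E = encodeSymbol (edgeRank , free (user []))
    p = encodeSymbol (vertexRank , free (name u))
    q = encodeSymbol (vertexRank , free (name v))

    encoded : ∀ b → concatMap encodeSymbol (prefix (cellFormula b u v)) ++ [ semi ] ≡ cellWord b u v
    encoded true = begin
      (E ++ p ++ q ++ []) ++ [ semi ]                     ≡⟨ cong (λ z → (E ++ p ++ z) ++ [ semi ]) (++-identityʳ q) ⟩
      (E ++ p ++ q) ++ [ semi ]                           ≡⟨ ++-assoc E (p ++ q) [ semi ] ⟩
      E ++ (p ++ q) ++ [ semi ]                           ≡⟨ cong (E ++_) (++-assoc p q [ semi ]) ⟩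
      E ++ p ++ q ++ [ semi ]                             ≡⟨ cong₂ (λ z w → E ++ z ++ w ++ [ semi ]) (encode-vertex u) (encode-vertex v) ⟩
      cellWord true u v                                   ∎
    encoded false = cong (_++ [ semi ]) (trans (++-identityʳ p) (encode-vertex u))

  encode-row : ∀ bs u v A → rowWord u v bs (encodeFormulas A) ≡ encodeFormulas (rowFormulas u v bs A)
  encode-row []       u v A = refl
  encode-row (b ∷ bs) u v A = trans (cong (rowWord u (suc v) bs) (encode-cell b u v A)) (encode-row bs u (suc v) _)

  encode-table : ∀ bss u A → tableWord u bss (encodeFormulas A) ≡ encodeFormulas (tableFormulas u bss A)
  encode-table []         u A = refl
  encode-table (bs ∷ bss) u A =
    trans (cong (tableWord (suc u) bss) (encode-row bs u 0 A)) (encode-table bss (suc u) _)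

  -- The accumulator reverses the row, and `shift` moves the cells back one at a time. Column
  -- numbers are given by `h`, so that dropping the first column yields an instance of the same
  -- statement.
  rowFormulas-↭ : ∀ {n} (g : Fin n → Bool) (h : Fin n → ℕ) {u v A} → (∀ j → v + toℕ j ≡ h j) →
    rowFormulas u v (tabulate g) A ↭ tabulate (λ j → cellFormula (g j) u (h j)) ++ A
  rowFormulas-↭ {zero}  g h v≡ = ↭-refl
  rowFormulas-↭ {suc n} g h {u} {v} {A} v≡ rewrite sym (v≡ zero) | +-identityʳ v =
    ↭-trans (rowFormulas-↭ (g ∘ suc) (h ∘ suc) (λ j → trans (sym (+-suc v _)) (v≡ (suc j))))
            (shift (cellFormula (g zero) u v) (tabulate (λ j → cellFormula (g (suc j)) u (h (suc j)))) A)

  tableFormulas-↭ : ∀ {m n} (g : Fin m → Fin n → Bool) (h : Fin m → ℕ) {u A} → (∀ i → u + toℕ i ≡ h i) →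
    tableFormulas u (tabulate (tabulate ∘ g)) A ↭
    concat (tabulate λ i → tabulate λ j → cellFormula (g i j) (h i) (toℕ j)) ++ A
  tableFormulas-↭ {zero}  g h u≡ = ↭-refl
  tableFormulas-↭ {suc m} g h {u} {A} u≡ rewrite sym (u≡ zero) | +-identityʳ u =
    ↭-trans (tableFormulas-↭ (g ∘ suc) (h ∘ suc) (λ i → trans (sym (+-suc u _)) (u≡ (suc i))))
      (↭-trans (↭-++⁺ˡ later (rowFormulas-↭ (g zero) toℕ (λ _ → refl)))
        (↭-trans (shifts later first) (↭-reflexive (sym (++-assoc first later A)))))
    where
    first = tabulate λ j → cellFormula (g zero j) u (toℕ j)
    later = concat (tabulate λ i → tabulate λ j → cellFormula (g (suc i) j) (h (suc i)) (toℕ j))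

  matrix : Graph → List Bits
  matrix G = tabulate λ u → tabulate λ v → adjacent G u v

  formulas : Graph → List Formula
  formulas G = tableFormulas 0 (matrix G) []

  map-cartesianProduct : ∀ {A B C : Set} (f : A × B → C) xs ys →
    map f (cartesianProduct xs ys) ≡ concat (map (λ x → map (λ y → f (x , y)) ys) xs)
  map-cartesianProduct f []       ys = refl
  map-cartesianProduct f (x ∷ xs) ys =
    trans (map-++ f (map (x ,_) ys) _) (cong₂ _++_ (sym (map-∘ ys)) (map-cartesianProduct f xs ys))

  map-pairs : ∀ {C : Set} n (f : Fin n × Fin n → C) →
    map f (pairs n) ≡ concat (tabulate λ u → tabulate λ v → f (u , v))
  map-pairs n f = trans (map-cartesianProduct f (allFin n) (allFin n))
    (cong concat (trans (map-tabulate id (λ u → map (λ v → f (u , v)) (allFin n)))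
                        (tabulate-cong λ u → map-tabulate id (λ v → f (u , v)))))

  describes-formulas : ∀ G → Describes G (formulas G)
  describes-formulas G = user [] , name ∘ toℕ , toℕ-injective ∘ name-injective ,
    ↭-trans (tableFormulas-↭ (adjacent G) toℕ (λ _ → refl))
      (↭-reflexive (trans (++-identityʳ _) (sym (map-pairs (order G) _))))

  reduction : (V : Pred FreeSymbol 0ℓ) (N : List Formula → List Formula) →
    Normalizing V N → GraphIsomorphism ≤ᵖᵀ Computing 𝒮 N
  reduction V N normalizing = 5 , program , totalCost , λ O solves b bounded (G , H) →
    let σ , t , yes? , run , t≤ , result , equal? = program-correct O bounded (matrix G) (matrix H)
    in σ , t , yes? , run , t≤ , result , decide O solves G H equal?
    where
    -- Inputs and outputs share one encoding, so the first answer is again a legitimate query.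
    answer-twice : ∀ O → Solves O (Computing 𝒮 N) → ∀ G →
      O (O (tableWord 0 (matrix G) [])) ≡ encodeFormulas (N (N (formulas G)))
    answer-twice O solves G =
      trans (cong (O ∘ O) (encode-table (matrix G) 0 []))
            (trans (cong O (solves (formulas G))) (solves (N (formulas G))))

    decide : ∀ O → Solves O (Computing 𝒮 N) → ∀ G H {yes?} →
      Reflects (O (O (tableWord 0 (matrix G) [])) ≡ O (O (tableWord 0 (matrix H) []))) yes? →
      Reflects (G ≅ H) yes?
    decide O solves G H (ofʸ eq) = ofʸ (normal-twice⇒≅ normalizing {G} {H} (describes-formulas G) (describes-formulas H)
      -- The machine compares words; unique readability carries equality back to formulas.
      (encodeFormulas-injective _ _ (trans (sym (answer-twice O solves G)) (trans eq (answer-twice O solves H)))))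
    decide O solves G H (ofⁿ ne) = ofⁿ λ G≅H → ne
      (trans (answer-twice O solves G) (trans
        (cong encodeFormulas (≅⇒normal-twice normalizing {G} {H} (describes-formulas G) (describes-formulas H) G≅H))
        (sym (answer-twice O solves H))))

mainTheorem2 : (𝒮 : Signature) → let open Logic 𝒮 in
    (V : Pred FreeSymbol 0ℓ) (N : List Formula → List Formula) →
    Normalizing V N → GraphIsomorphism ≤ᵖᵀ Computing 𝒮 N
mainTheorem2 = Reduction.reduction
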